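{- Let $0<\epsilon<1$. Given an undirected graph $G=(V,E)$ on $m$ edges and $n$ vertices with non-negative edge weights (with ratio between largest and smallest edge weight at most $\mathrm{poly}(n)$) and a set of terminals $T\subseteq V$ with $|T|\ge2$, the following algorithm computes a $(1+\epsilon)$-approximate minimum Steiner cut for $T$ with probability at least $1-1/n$ in $\tilde{O}(m)$ time. Algorithm: for each $i=1,\dots,\lceil\log_2|T|\rceil$ and each $j=1,\dots,\lceil\log_{8/7}n\rceil$, draw independently a random subset $T_{ij}\subseteq T$ in which every vertex $t\in T$ appears independently with probability $1/2^i$, and use the isolating-cuts subroutine described in the context to find $(1+\epsilon)$-approximate minimum isolating cuts $\mathcal S_{ij}=\{S_t:t\in T_{ij}\}$ for the terminal set $T_{ij}$. Return a set $S$ minimizing $\delta(S)$ over all $S\in\mathcal S_{ij}$, $i\in\{1,\dots,\lceil\log_2|T|\rceil\}$, $j\in\{1,\dots,\lceil\log_{8/7}n\rceil\}$.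
   Context: $\tilde O$ hides $\mathrm{polylog}(n)$ factors ($\epsilon$ is treated as a constant). $\delta(S)$ is the total weight of edges between $S$ and $V\setminus S$. A Steiner cut for $T$ is a set $\emptyset\subset S\subset V$ with $\emptyset\subset S\cap T\subset T$ (strict inclusions); its value is $\delta(S)$. A minimum Steiner cut is a Steiner cut of minimum value, and a $(1+\epsilon)$-approximate minimum Steiner cut is a Steiner cut whose value is at most $(1+\epsilon)$ times the minimum. Isolating-cuts subroutine: for a terminal set $R\subseteq V$, an isolating cut for $t\in R$ is a set $\emptyset\subset S\subset V$ with $R\cap S=\{t\}$; a $(1+\epsilon)$-approximate minimum isolating cut for $t$ is an isolating cut for $t$ of value at most $(1+\epsilon)$ times the minimum value of an isolating cut for $t$. The subroutine takes $G$ and $R$ and, in $\tilde O(m/\epsilon^3)$ time, outputs for every $t\in R$ a $(1+\epsilon)$-approximate minimum isolating cut $S_t$; the sets $S_t$ are disjoint, and, with $\gamma=\epsilon/(4\lceil\log_2|R|\rceil)$, for each $t\in R$ there is a feasible flow (respecting capacities equal to the edge weights) with zero net flow out of every vertex of $S_t\setminus\{t\}$ that sends at least $\frac1{1+\gamma}$ times the weight of every edge between $S_t$ and $V\setminus S_t$ in the direction from $S_t$ to $V\setminus S_t$.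
   Formalization: Samples T_ij with fewer than two terminals contribute no cuts (γ is undefined there and the literal algorithm can return a non-Steiner cut); the Õ(m) bound assumes n ≤ a·m for an arbitrary constant a; weights and ε lie in any Archimedean ordered field with decidable order. -}

module Defs where

open import Algebra.Bundles using (CommutativeRing)
import Algebra.Definitions.RawMonoid as RawMonoidDefs
open import Data.Bool.Base using (Bool; true; false; if_then_else_; _xor_)
open import Data.Fin.Base as Fin using (Fin)
import Data.Fin.Properties as Finₚ
open import Data.Fin.Subset using (Subset; inside; outside; _∈_; _∉_; _⊂_; _∩_; ⊤; ⊥; ⁅_⁆; ∣_∣; Empty)
open import Data.Fin.Subset.Properties using (_∈?_; _⊂?_; anySubset?)
open import Data.List.Base using (List; []; _∷_; filter; allFin; applyUpTo)
open import Data.Maybe.Base as Maybe using (Maybe; just; nothing)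
open import Data.Nat.Base as ℕ using (ℕ; zero; suc; _^_)
open import Data.Nat.Logarithm using (⌈log₂_⌉)
import Data.Nat.Properties as ℕₚ
open import Data.Product.Base using (∃; ∃₂; _×_; _,_; proj₁; proj₂)
open import Data.Rational.Base as ℚ using (ℚ; 0ℚ; 1ℚ; ½)
open import Data.Sum.Base using (_⊎_)
open import Data.Vec.Base using ([]; _∷_; lookup)
open import Function.Base using (_∘_)
open import Function.Definitions using (Injective)
open import Level using (Level; _⊔_) renaming (suc to lsuc)
open import Relation.Binary.Core using (Rel)
open import Relation.Binary.PropositionalEquality.Core using (_≡_; _≢_)
open import Relation.Binary.Structures using (IsDecTotalOrder)
open import Relation.Nullary.Decidable using (Dec; does; yes; no; ¬?; _×-dec_; _⊎-dec_; decidable-stable)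
open import Relation.Nullary.Negation using (¬_)
open import Relation.Unary using (Pred; Decidable)

private
  variable
    a b c ℓ₁ ℓ₂ p : Level

-- Edge weights and ε live in an arbitrary Archimedean ordered field with
-- decidable order.  Classically these are exactly the subfields of ℝ, with ℝ
-- itself included.

record ArchimedeanOrderedField c ℓ₁ ℓ₂ : Set (lsuc (c ⊔ ℓ₁ ⊔ ℓ₂)) where
  infix 4 _≤_ _<_
  field
    commutativeRing : CommutativeRing c ℓ₁

  open CommutativeRing commutativeRing public
  open RawMonoidDefs +-rawMonoid public using (sum) renaming (_×_ to _·_)

  field
    _≤_             : Rel Carrier ℓ₂
    isDecTotalOrder : IsDecTotalOrder _≈_ _≤_
    0≉1             : ¬ 0# ≈ 1#
    inverse         : ∀ x → ¬ x ≈ 0# → ∃ λ y → x * y ≈ 1#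
    +-monoʳ-≤       : ∀ z {x y} → x ≤ y → z + x ≤ z + y
    *-nonNegative   : ∀ {x y} → 0# ≤ x → 0# ≤ y → 0# ≤ x * y
    archimedean     : ∀ x → ∃ λ N → x ≤ N · 1#

  open IsDecTotalOrder isDecTotalOrder public using (_≤?_)

  _<_ : Rel Carrier (ℓ₁ ⊔ ℓ₂)
  x < y = x ≤ y × ¬ x ≈ y

-- The first k ≥ k₀ with n ≤ (8/7)ᵏ, if found within the given fuel.
searchLog₈⸝₇ : (n fuel k₀ : ℕ) → ℕ
searchLog₈⸝₇ n zero       k = k
searchLog₈⸝₇ n (suc fuel) k =
  if does (n ℕ.* 7 ^ k ℕₚ.≤? 8 ^ k) then k else searchLog₈⸝₇ n fuel (suc k)

-- The fuel 7 n suffices: (8/7)^(7n) ≥ 1 + n by Bernoulli's inequality.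
⌈log₈⸝₇_⌉ : ℕ → ℕ
⌈log₈⸝₇ n ⌉ = searchLog₈⸝₇ n (7 ℕ.* n) 0

-- Randomised programs with a running time.  `charge k` spends k elementary
-- steps; `draw i` yields `true` with probability 1/2ⁱ, independently of all
-- other draws, at the price of i fair coin tosses.

data Prog {a} (A : Set a) : Set a where
  return : A → Prog A
  charge : ℕ → Prog A → Prog A
  draw   : ℕ → (Bool → Prog A) → Prog A

infixl 1 _>>=_

_>>=_ : {A : Set a} {B : Set b} → Prog A → (A → Prog B) → Prog B
return x   >>= f = f x
charge k q >>= f = charge k (q >>= f)
draw i q   >>= f = draw i (λ x → q x >>= f)

forEach : {A : Set a} {B : Set b} → List A → B → (A → B → Prog B) → Prog B
forEach []       s body = return s
forEach (x ∷ xs) s body = body x s >>= λ s′ → forEach xs s′ body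

2⁻_ : ℕ → ℚ
2⁻ zero  = 1ℚ
2⁻ suc i = ½ ℚ.* 2⁻ i

module _ {A : Set a} where

  Pr : Prog A → {P : Pred A p} → Decidable P → ℚ
  Pr (return x)   P? = if does (P? x) then 1ℚ else 0ℚ
  Pr (charge _ q) P? = Pr q P?
  Pr (draw i q)   P? =
    2⁻ i ℚ.* Pr (q true) P? ℚ.+ (1ℚ ℚ.- 2⁻ i) ℚ.* Pr (q false) P?

  -- Worst case over the outcomes of all draws.
  time : Prog A → ℕ
  time (return _)   = 0
  time (charge k q) = k ℕ.+ time q
  time (draw i q)   = i ℕ.+ (time (q true) ℕ.⊔ time (q false))

-- Each element of the given set is kept independently with probability 1/2ⁱ.
sample : ∀ {n} → ℕ → Subset n → Prog (Subset n)
sample i []            = return []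
sample i (outside ∷ T) = charge 1 (sample i T >>= λ R → return (outside ∷ R))
sample i (inside  ∷ T) = charge 1 (draw i λ t∈R →
  sample i T >>= λ R → return ((if t∈R then inside else outside) ∷ R))

elements : ∀ {n} → Subset n → List (Fin n)
elements S = filter (_∈? S) (allFin _)

SteinerCut : ∀ {n} → Subset n → Subset n → Set
SteinerCut T S = (⊥ ⊂ S × S ⊂ ⊤) × (⊥ ⊂ S ∩ T × S ∩ T ⊂ T)

steinerCut? : ∀ {n} (T : Subset n) → Decidable (SteinerCut T)
steinerCut? T S =
  ((⊥ ⊂? S) ×-dec (S ⊂? ⊤)) ×-dec ((⊥ ⊂? S ∩ T) ×-dec (S ∩ T ⊂? T))

IsolatingCut : ∀ {n} → Subset n → Fin n → Subset n → Set
IsolatingCut R t S = (⊥ ⊂ S × S ⊂ ⊤) × R ∩ S ≡ ⁅ t ⁆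

module _ (K : ArchimedeanOrderedField c ℓ₁ ℓ₂) where

  open ArchimedeanOrderedField K

  -- A simple graph: every edge is listed once, as a pair whose first endpoint
  -- is the smaller one.

  record Graph (n m : ℕ) : Set (c ⊔ ℓ₂) where
    field
      ends            : Fin m → Fin n × Fin n
      ends-ordered    : ∀ e → proj₁ (ends e) Fin.< proj₂ (ends e)
      ends-injective  : Injective _≡_ _≡_ ends
      weight          : Fin m → Carrier
      weight-nonNeg   : ∀ e → 0# ≤ weight e

    src tgt : Fin m → Fin n
    src = proj₁ ∘ ends
    tgt = proj₂ ∘ ends

    crosses : Subset n → Fin m → Bool
    crosses S e = lookup S (src e) xor lookup S (tgt e)

    δ : Subset n → Carrier
    δ S = sum λ e → if crosses S e then weight e else 0#

    incident : Fin n → List (Fin m)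
    incident v = filter (λ e → (v Finₚ.≟ src e) ⊎-dec (v Finₚ.≟ tgt e)) (allFin m)

    -- A flow is a signed value on each edge, positive from `src` to `tgt`.
    netOut : (Fin m → Carrier) → Fin n → Carrier
    netOut f v = sum λ e →
      if does (v Finₚ.≟ src e) then f e else
      if does (v Finₚ.≟ tgt e) then - f e else 0#

  open Graph

  WeightRatioAtMost : ∀ {n m} → ℕ → Graph n m → Set ℓ₂
  WeightRatioAtMost r G = ∀ e e′ → weight G e ≤ r · weight G e′

  module _ {n : ℕ} (P : Pred (Subset n) p) (f : Subset n → Carrier) where

    IsMinimum : Subset n → Set (ℓ₂ ⊔ p)
    IsMinimum S = P S × (∀ S′ → P S′ → f S ≤ f S′)

    IsApproxMinimum : Carrier → Subset n → Set (ℓ₂ ⊔ p)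
    IsApproxMinimum ε S =
      P S × ∃ λ S* → IsMinimum S* × f S ≤ (1# + ε) * f S*

    isMinimum? : Decidable P → Decidable IsMinimum
    isMinimum? P? S = P? S ×-dec below
      where
      below : Dec (∀ S′ → P S′ → f S ≤ f S′)
      below with anySubset? (λ S′ → P? S′ ×-dec ¬? (f S ≤? f S′))
      ... | yes (S′ , PS′ , ≰) = no λ all → ≰ (all S′ PS′)
      ... | no ∄ = yes λ S′ PS′ →
        decidable-stable (f S ≤? f S′) λ ≰ → ∄ (S′ , PS′ , ≰)

    isApproxMinimum? : Decidable P → ∀ ε → Decidable (IsApproxMinimum ε)
    isApproxMinimum? P? ε S =
      P? S ×-dec
      anySubset? (λ S* → isMinimum? P? S* ×-dec (f S ≤? (1# + ε) * f S*))

  ApproxMinSteinerCut : ∀ {n m} → Carrier → Graph n m → Subset n → Subset n → Set ℓ₂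
  ApproxMinSteinerCut ε G T = IsApproxMinimum (SteinerCut T) (δ G) ε

  approxMinSteinerCut? : ∀ {n m} ε (G : Graph n m) T → Decidable (ApproxMinSteinerCut ε G T)
  approxMinSteinerCut? ε G T =
    isApproxMinimum? (SteinerCut T) (δ G) (steinerCut? T) ε

  ApproxMinIsolatingCut : ∀ {n m} → Carrier → Graph n m → Subset n → Fin n → Subset n → Set ℓ₂
  ApproxMinIsolatingCut ε G R t = IsApproxMinimum (IsolatingCut R t) (δ G) ε

  -- A feasible flow that is conserved on S ∖ {t} and sends at least the
  -- fraction ρ of the weight of every boundary edge of S out of S.

  record SaturatingFlow {n m} (G : Graph n m) (S : Subset n) (t : Fin n) (ρ : Carrier)
                        : Set (c ⊔ ℓ₁ ⊔ ℓ₂) where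
    field
      flow      : Fin m → Carrier
      feasible  : ∀ e → flow e ≤ weight G e × - flow e ≤ weight G e
      conserved : ∀ v → v ∈ S → v ≢ t → netOut G flow v ≈ 0#
      src-side  : ∀ e → src G e ∈ S → tgt G e ∉ S → ρ * weight G e ≤ flow e
      tgt-side  : ∀ e → src G e ∉ S → tgt G e ∈ S → ρ * weight G e ≤ - flow e

  -- The isolating-cuts subroutine for a fixed ε.  Its guarantees concern
  -- terminal sets with at least two elements (for |R| = 1 the quantity γ below
  -- is undefined); `cuts G R t` is meaningful only for t ∈ R.
  --
  -- Õ(m) presupposes n = O(m), since n vertices cannot even be read in Õ(m)
  -- time otherwise: the bounds are uniform over graphs with n ≤ a m, for every
  -- constant a, and with weight ratio at most nᵈ, for every constant d.

  record IsolatingCuts (ε : Carrier) : Set (c ⊔ ℓ₁ ⊔ ℓ₂) where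
    field
      cuts : ∀ {n m} → Graph n m → Subset n → Fin n → Subset n
      cost : ∀ {n m} → Graph n m → Subset n → ℕ

      approximate : ∀ {n m} (G : Graph n m) R → 2 ℕ.≤ ∣ R ∣ →
                    ∀ t → t ∈ R → ApproxMinIsolatingCut ε G R t (cuts G R t)

      disjoint    : ∀ {n m} (G : Graph n m) R → 2 ℕ.≤ ∣ R ∣ →
                    ∀ t t′ → t ∈ R → t′ ∈ R → t ≢ t′ →
                    Empty (cuts G R t ∩ cuts G R t′)

      -- γ = ε / (4 ⌈log₂ |R|⌉) and ρ = 1 / (1 + γ)
      saturated   : ∀ {n m} (G : Graph n m) R → 2 ℕ.≤ ∣ R ∣ →
                    ∀ γ ρ → (4 ℕ.* ⌈log₂ ∣ R ∣ ⌉) · γ ≈ ε → (1# + γ) * ρ ≈ 1# →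
                    ∀ t → t ∈ R → SaturatingFlow G (cuts G R t) t ρ

      -- cost = Õ(m / ε³)
      cost-bound  : ∀ d a → ∃₂ λ C k → ∀ {n m} (G : Graph n m) →
                    WeightRatioAtMost (n ^ d) G → n ℕ.≤ a ℕ.* m →
                    ∀ R → 2 ℕ.≤ ∣ R ∣ →
                    cost G R · (ε * ε * ε) ≤ (C ℕ.* m ℕ.* ⌈log₂ n ⌉ ^ k) · 1#

  module _ {ε : Carrier} (A : IsolatingCuts ε) {n m : ℕ} (G : Graph n m) where

    open IsolatingCuts A

    -- Computes δ S by scanning only the adjacency lists of the vertices of S.
    cutValue : Subset n → Prog Carrier
    cutValue S = forEach (elements S) 0# λ v x →
      charge 1 (forEach (incident G v) x λ e y →
        charge 1 (return (if crosses G S e then y + weight G e else y)))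

    Best : Set c
    Best = Maybe (Carrier × Subset n)

    better : Subset n → Carrier → Best → Best
    better S x nothing         = just (x , S)
    better S x (just (y , S′)) = if does (y ≤? x) then just (y , S′) else just (x , S)

    improve : Subset n → Best → Prog Best
    improve S best = cutValue S >>= λ x → charge 1 (return (better S x best))

    -- Terminal sets with fewer than two elements contribute no cuts; the
    -- charge of n pays for computing |R|.
    round : Subset n → ℕ → Best → Prog Best
    round T i best = sample i T >>= λ R → charge n (
      if does (2 ℕₚ.≤? ∣ R ∣)
      then charge (cost G R) (forEach (elements R) best λ t best′ →
             charge 1 (improve (cuts G R t) best′))
      else return best)

    -- The charges of n pay for computing |T| and for writing the output.  The
    -- result is `nothing` if no cut was found in any round.
    approxSteinerCut : Subset n → Prog (Maybe (Subset n))
    approxSteinerCut T = charge n (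
      forEach (applyUpTo suc ⌈log₂ ∣ T ∣ ⌉) nothing (λ i best →
        charge 1 (forEach (applyUpTo suc ⌈log₈⸝₇ n ⌉) best λ j best′ →
          charge 1 (round T i best′)))
      >>= λ best → charge n (return (Maybe.map proj₂ best)))

{-# OPTIONS --safe #-}
module Submission where

-- Let S be a minimum Steiner cut with k = |T ∩ S| ≤ l = |T ∖ S|, and let N = 2ⁱ
-- with N ≤ k + 1 < 2 N and p = 1/N.  A sample R at rate p meets S in exactly one
-- terminal with probability k p (1 - p)ᵏ⁻¹ ≥ 1/4, and independently it meets the
-- complement with probability 1 - (1 - p)ˡ ≥ 1/2.  If both happen, S is an
-- isolating cut for the terminal in R ∩ S, so the round yields a Steiner cut of
-- value at most (1 + ε) δ(S).  All ⌈log_{8/7} n⌉ rounds at this rate fail with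
-- probability at most (7/8)^⌈log_{8/7} n⌉ ≤ 1/n.
--
-- For the running time, the cuts of one round are disjoint, so evaluating all of
-- them scans each vertex at most once and each edge at most twice.

open import Defs
open import Algebra.Bundles using (CommutativeMonoid; CommutativeRing)
import Algebra.Lattice.Properties.BooleanAlgebra as BooleanAlgebra
import Algebra.Properties.CommutativeMonoid.Sum as Sum
import Algebra.Properties.CommutativeSemiring.Exp as Exp
import Algebra.Properties.Ring as RingProperties
import Algebra.Properties.Semiring.Mult as Mult
open import Data.Bool.Base using (true; false; if_then_else_; not; _xor_)
open import Data.Fin.Base using (Fin; zero; suc)
import Data.Fin.Properties as Finₚ
open import Data.Fin.Subset using (Subset; inside; outside; _∩_; ∁; ∣_∣; _⊆_; _∈_; ⊥; ⁅_⁆; Nonempty)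
open import Data.Fin.Subset.Properties
open import Data.Integer.Base as ℤ using (+_)
import Data.Integer.Properties as ℤₚ
open import Data.List.Base using ([]; _∷_; length; foldr; filter; tabulate; allFin; applyUpTo)
open import Data.List.Membership.Propositional using () renaming (_∈_ to _∈ₗ_)
open import Data.List.Membership.Propositional.Properties using (∈-applyUpTo⁺; ∈-applyUpTo⁻; ∈-filter⁺; ∈-filter⁻; ∈-allFin)
open import Data.List.Properties using (length-applyUpTo)
open import Data.List.Relation.Unary.Any using (here; there)
open import Data.Maybe.Base as Maybe using (just; nothing)
open import Data.Maybe.Relation.Unary.All using (All; just; nothing)
open import Data.Maybe.Relation.Unary.Any using (Any; just; dec)
open import Data.Nat.Base as ℕ using (ℕ; zero; suc; z≤n; s≤s; NonZero; ⌈_/2⌉; ⌊_/2⌋)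
open import Data.Nat.Induction using (<-rec)
open import Data.Nat.Logarithm using (⌈log₂_⌉; ⌈log₂⌈n/2⌉⌉≡⌈log₂n⌉∸1; ⌈log₂⌉-mono-≤; ⌈log₂2^n⌉≡n)
import Data.Nat.Properties as ℕₚ
import Data.Nat.Solver as ℕSolver
open import Data.Product.Base using (∃; ∃₂; _×_; _,_; proj₁; proj₂)
open import Data.Rational.Base as ℚ using (ℚ; 0ℚ; 1ℚ; ½)
import Data.Rational.Properties as ℚₚ
import Data.Rational.Solver as ℚSolver
import Data.Rational.Unnormalised.Base as ℚᵘ
import Data.Rational.Unnormalised.Properties as ℚᵘₚ
open import Data.Sum.Base using (_⊎_; inj₁; inj₂; [_,_]′)
open import Data.Unit.Polymorphic.Base using (tt) renaming (⊤ to Unit)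
open import Data.Vec.Base using ([]; _∷_; lookup)
open import Data.Vec.Properties using (lookup⇒[]=; []=⇒lookup; lookup-map)
open import Function.Base using (_∘_; id)
open import Level using (Level; 0ℓ; _⊔_)
open import Relation.Binary.PropositionalEquality as ≡ using (_≡_; _≢_)
open import Relation.Binary.Structures using (IsDecTotalOrder)
open import Relation.Nullary.Decidable using (does; yes; no; dec-true; dec-false; _×-dec_; _⊎-dec_)
open import Relation.Nullary.Negation using (¬_; contradiction)
open import Relation.Unary using (Pred; Decidable)

-- Binomial probabilities

-- Comparing `N` with `k + 1` rather than `k` keeps `p ≤ 1/2` even when a single terminal lies on
-- the small side, and makes `(N - 1) p = 1 - p` the relation from which both estimates start. For
-- `k ≥ N - 1`, exactly one hit is at least as likely as none, so its probability can only fall as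
-- `k` grows; the worst case is `k = 2 N - 2`, where it equals `2 (1 - p)ᵏ`. Behind the 1/4 stands
-- `(1 - 1/N)^(2N-1) ≥ 1/8`: these numbers tend to `e⁻² > 1/8`, and since only powers of two occur,
-- they are handled inside `ℚ` by repeated doubling of `N`.
--
-- A round starts from the best cut found so far, so the rounds of the program are not separate
-- experiments whose failure probabilities could simply be multiplied. Instead the failure indicator
-- is followed through the loops: from every state a round does not raise its expectation, and a
-- round at the right rate shrinks it by the factor 7/8 = 1 - 1/4 · 1/2. This works because a good
-- best cut is never lost.

module RationalBounds where

  open import Data.Rational.Base using (_+_; _*_; -_; _-_; _≤_; positive; nonNegative; toℚᵘ)
  open ℚₚ
  open ≡ using (refl; sym; trans; cong; cong₂; subst; subst₂; module ≡-Reasoning)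
  open ℚSolver.+-*-Solver
  open CommutativeRing +-*-commutativeRing using (commutativeSemiring; semiring)
  open Exp commutativeSemiring using (_^_; ^-homo-*; ^-distrib-*)
  open Mult semiring using (×-homo-+; ×-assoc-*; ×-comm-*; ×-assocˡ) renaming (_×_ to _·_)

  *-nonNeg : ∀ {x y} → 0ℚ ≤ x → 0ℚ ≤ y → 0ℚ ≤ x * y
  *-nonNeg {x} {y} 0≤x 0≤y =
    nonNegative⁻¹ (x * y) {{nonNeg*nonNeg⇒nonNeg x {{nonNegative 0≤x}} y {{nonNegative 0≤y}}}}

  +-nonNeg : ∀ {x y} → 0ℚ ≤ x → 0ℚ ≤ y → 0ℚ ≤ x + y
  +-nonNeg 0≤x 0≤y = +-mono-≤ 0≤x 0≤y

  *-monoˡ-≤ : ∀ {z x y} → 0ℚ ≤ z → x ≤ y → z * x ≤ z * y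
  *-monoˡ-≤ {z} 0≤z = *-monoˡ-≤-nonNeg z {{nonNegative 0≤z}}

  *-monoʳ-≤ : ∀ {z x y} → 0ℚ ≤ z → x ≤ y → x * z ≤ y * z
  *-monoʳ-≤ {z} 0≤z = *-monoʳ-≤-nonNeg z {{nonNegative 0≤z}}

  ≤-by-difference : ∀ {x y} d → 0ℚ ≤ d → y ≡ x + d → x ≤ y
  ≤-by-difference {x} {y} d 0≤d y≡x+d =
    subst₂ _≤_ (+-identityʳ x) (sym y≡x+d) (+-monoʳ-≤ x 0≤d)

  difference-nonNeg : ∀ {x y} → x ≤ y → 0ℚ ≤ y - x
  difference-nonNeg {x} {y} x≤y = subst (_≤ y - x) (+-inverseʳ x) (+-monoˡ-≤ (- x) x≤y)

  0≤½ : 0ℚ ≤ ½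
  0≤½ = ≤ᵇ⇒≤ _

  ^-nonNeg : ∀ {x} → 0ℚ ≤ x → ∀ k → 0ℚ ≤ x ^ k
  ^-nonNeg 0≤x zero    = ≤ᵇ⇒≤ _
  ^-nonNeg 0≤x (suc k) = *-nonNeg 0≤x (^-nonNeg 0≤x k)

  ·-nonNeg : ∀ {x} → 0ℚ ≤ x → ∀ k → 0ℚ ≤ k · x
  ·-nonNeg 0≤x zero    = ≤-refl
  ·-nonNeg 0≤x (suc k) = +-nonNeg 0≤x (·-nonNeg 0≤x k)

  ^-antimono : ∀ {x} → 0ℚ ≤ x → x ≤ 1ℚ → ∀ {j k} → j ℕ.≤ k → x ^ k ≤ x ^ j
  ^-antimono {x} 0≤x x≤1 {j} {k} j≤k with ℕₚ.m≤n⇒∃[o]m+o≡n j≤k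
  ... | d , refl = begin
    x ^ (j ℕ.+ d)  ≡⟨ ^-homo-* x j d ⟩
    x ^ j * x ^ d  ≤⟨ *-monoˡ-≤ (^-nonNeg 0≤x j) (x^d≤1 d) ⟩
    x ^ j * 1ℚ     ≡⟨ *-identityʳ _ ⟩
    x ^ j          ∎
    where
    open ≤-Reasoning
    x^d≤1 : ∀ d → x ^ d ≤ 1ℚ
    x^d≤1 zero    = ≤-refl
    x^d≤1 (suc d) = begin
      x * x ^ d  ≤⟨ *-monoˡ-≤ 0≤x (x^d≤1 d) ⟩
      x * 1ℚ     ≡⟨ *-identityʳ x ⟩
      x          ≤⟨ x≤1 ⟩
      1ℚ         ∎

  2⁻-nonNeg : ∀ i → 0ℚ ≤ 2⁻ i
  2⁻-nonNeg zero    = ≤ᵇ⇒≤ _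
  2⁻-nonNeg (suc i) = *-nonNeg 0≤½ (2⁻-nonNeg i)

  2⁻≤1 : ∀ i → 2⁻ i ≤ 1ℚ
  2⁻≤1 zero    = ≤-refl
  2⁻≤1 (suc i) = ≤-trans (*-monoˡ-≤ 0≤½ (2⁻≤1 i)) (≤ᵇ⇒≤ _)

  2⁻1+i≤½ : ∀ i → 2⁻ suc i ≤ ½
  2⁻1+i≤½ i = *-monoˡ-≤ 0≤½ (2⁻≤1 i)

  1-2⁻-nonNeg : ∀ i → 0ℚ ≤ 1ℚ - 2⁻ i
  1-2⁻-nonNeg i = difference-nonNeg (2⁻≤1 i)

  ½≤1-2⁻1+i : ∀ i → ½ ≤ 1ℚ - 2⁻ suc i
  ½≤1-2⁻1+i i = +-monoʳ-≤ 1ℚ (neg-antimono-≤ (2⁻1+i≤½ i))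

  1-2⁻≤1 : ∀ i → 1ℚ - 2⁻ i ≤ 1ℚ
  1-2⁻≤1 i = ≤-by-difference (2⁻ i) (2⁻-nonNeg i)
    (solve 1 (λ p → con 1ℚ := (con 1ℚ :- p) :+ p) refl (2⁻ i))

  2^i·2⁻i≡1 : ∀ i → (2 ℕ.^ i) · (2⁻ i) ≡ 1ℚ
  2^i·2⁻i≡1 zero    = refl
  2^i·2⁻i≡1 (suc i) = begin
    (2 ℕ.* N) · (½ * p)            ≡⟨ ×-assocˡ (½ * p) 2 N ⟨
    2 · (N · (½ * p))              ≡⟨ cong (2 ·_) (×-comm-* N ½ p) ⟨
    2 · (½ * (N · p))              ≡⟨ cong (λ z → 2 · (½ * z)) (2^i·2⁻i≡1 i) ⟩
    1ℚ                             ∎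
    where
    open ≡-Reasoning
    N = 2 ℕ.^ i
    p = 2⁻ i

  module _ {y p : ℚ} (0≤p : 0ℚ ≤ p) (0≤y : 0ℚ ≤ y) where

    -- Bernoulli's inequality for 1 + p/y, multiplied by y^(m+1).
    bernoulli : ∀ m → y ^ m * (y + m · p) ≤ y * (y + p) ^ m
    bernoulli zero    = ≤-reflexive (solve 1 (λ y → con 1ℚ :* (y :+ con 0ℚ) := y :* con 1ℚ) refl y)
    bernoulli (suc m) = begin
      y * y ^ m * (y + (p + m · p))
        ≤⟨ ≤-by-difference (y ^ m * (p * (m · p))) (*-nonNeg (^-nonNeg 0≤y m) (*-nonNeg 0≤p (·-nonNeg 0≤p m)))
             (solve 4 (λ y a p x → (y :+ p) :* (a :* (y :+ x)) := (y :* a :* (y :+ (p :+ x))) :+ a :* (p :* x))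
               refl y (y ^ m) p (m · p)) ⟩
      (y + p) * (y ^ m * (y + m · p))
        ≤⟨ *-monoˡ-≤ (+-nonNeg 0≤y 0≤p) (bernoulli m) ⟩
      (y + p) * (y * (y + p) ^ m)
        ≡⟨ solve 3 (λ y p b → (y :+ p) :* (y :* b) := y :* ((y :+ p) :* b)) refl y p ((y + p) ^ m) ⟩
      y * ((y + p) * (y + p) ^ m) ∎
      where open ≤-Reasoning

  module _ (i : ℕ) where

    private
      N = 2 ℕ.^ suc i
      p = 2⁻ suc i
      y = 1ℚ - p

      0≤p : 0ℚ ≤ p
      0≤p = 2⁻-nonNeg (suc i)

      0≤y : 0ℚ ≤ y
      0≤y = 1-2⁻-nonNeg (suc i)

      instance
        y-positive : ℚ.Positive y
        y-positive = positive (<-≤-trans (positive⁻¹ ½) (½≤1-2⁻1+i i))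

    [1+k]≡2^⇒k·p≡1-p : ∀ {k} → suc k ≡ N → k · p ≡ y
    [1+k]≡2^⇒k·p≡1-p {k} 1+k≡N = begin
      k · p              ≡⟨ solve 2 (λ x p → x := (p :+ x) :- p) refl (k · p) p ⟩
      suc k · p - p      ≡⟨ cong (λ z → z · p - p) 1+k≡N ⟩
      N · p - p          ≡⟨ cong (_- p) (2^i·2⁻i≡1 (suc i)) ⟩
      y                  ∎
      where open ≡-Reasoning

    -- At exponent `k₀ = N - 1` the identity `k₀ · p ≡ y` turns Bernoulli's left side into
    -- `2 y · y ^ k₀`, while `y + p = 1` turns its right side into `y`. Larger exponents only make
    -- the power smaller.
    [1-p]^k≤½ : ∀ k → N ℕ.≤ suc k → y ^ k ≤ ½
    [1-p]^k≤½ k N≤1+k = ≤-trans (^-antimono 0≤y (1-2⁻≤1 (suc i)) (ℕₚ.≤-pred N≤1+k′)) y^k₀≤½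
      where
      k₀ = ℕ.pred N
      1+k₀≡N : suc k₀ ≡ N
      1+k₀≡N = ℕₚ.suc-pred N {{ℕₚ.m^n≢0 2 (suc i)}}
      N≤1+k′ : suc k₀ ℕ.≤ suc k
      N≤1+k′ = subst (ℕ._≤ suc k) (sym 1+k₀≡N) N≤1+k
      open ≤-Reasoning
      1^m≡1 : ∀ m → 1ℚ ^ m ≡ 1ℚ
      1^m≡1 zero    = refl
      1^m≡1 (suc m) = trans (*-identityˡ _) (1^m≡1 m)
      y^k₀≤½ : y ^ k₀ ≤ ½
      y^k₀≤½ = *-cancelˡ-≤-pos y (begin
        y * y ^ k₀
          ≡⟨ solve 2 (λ y b → y :* b := con ½ :* (b :* (y :+ y))) refl y (y ^ k₀) ⟩
        ½ * (y ^ k₀ * (y + y))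
          ≡⟨ cong (λ z → ½ * (y ^ k₀ * (y + z))) ([1+k]≡2^⇒k·p≡1-p 1+k₀≡N) ⟨
        ½ * (y ^ k₀ * (y + k₀ · p))
          ≤⟨ *-monoˡ-≤ 0≤½ (bernoulli 0≤p 0≤y k₀) ⟩
        ½ * (y * (y + p) ^ k₀)
          ≡⟨ cong (λ z → ½ * (y * z ^ k₀)) (solve 1 (λ p → (con 1ℚ :- p) :+ p := con 1ℚ) refl p) ⟩
        ½ * (y * 1ℚ ^ k₀)
          ≡⟨ cong (λ z → ½ * (y * z)) (1^m≡1 k₀) ⟩
        ½ * (y * 1ℚ)
          ≡⟨ solve 1 (λ y → con ½ :* (y :* con 1ℚ) := y :* con ½) refl y ⟩
        y * ½ ∎)

    2N·p≡2 : (2 ℕ.* N) · p ≡ 1ℚ + 1ℚ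
    2N·p≡2 = trans (sym (×-assocˡ p 2 N)) (cong (2 ·_) (2^i·2⁻i≡1 (suc i)))

    -- With M = 2 N - 1: (1 - 1/N)^(2N-1) does not decrease when N is doubled, and it
    -- equals 1/8 at N = 2.
    [1-p]^M-doubling : ∀ M → suc M ≡ 2 ℕ.* N →
                       y ^ M ≤ (1ℚ - ½ * p) ^ suc (M ℕ.+ M)
    [1-p]^M-doubling M 1+M≡2N = *-cancelˡ-≤-pos y (begin
      y * y ^ M
        -- Here `y′² = y + c` with `c = p²/4`, and `M · p = 2 - p` gives `M · c = p (2 - p) / 4`.
        -- Hence `y′ (y + M · c)` exceeds `y` by exactly `p³/8`, which leaves room for Bernoulli's
        -- inequality.
        ≤⟨ ≤-by-difference (y ^ M * (½ * ½ * ½ * (p * p * p)))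
             (*-nonNeg (^-nonNeg 0≤y M) (*-nonNeg {½ * ½ * ½} (≤ᵇ⇒≤ _) (*-nonNeg (*-nonNeg 0≤p 0≤p) 0≤p)))
             gain ⟩
      y′ * (y ^ M * (y + M · c))
        ≤⟨ *-monoˡ-≤ 0≤y′ (bernoulli 0≤c 0≤y M) ⟩
      y′ * (y * (y + c) ^ M)
        ≡⟨ cong (λ z → y′ * (y * z ^ M))
             (solve 1 (λ p → (con 1ℚ :- p) :+ con (½ * ½) :* (p :* p)
                             := (con 1ℚ :- con ½ :* p) :* (con 1ℚ :- con ½ :* p)) refl p) ⟩
      y′ * (y * (y′ * y′) ^ M)
        ≡⟨ cong (λ z → y′ * (y * z)) (trans (^-distrib-* y′ y′ M) (sym (^-homo-* y′ M M))) ⟩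
      y′ * (y * y′ ^ (M ℕ.+ M))
        ≡⟨ solve 3 (λ a y b → a :* (y :* b) := y :* (a :* b)) refl y′ y (y′ ^ (M ℕ.+ M)) ⟩
      y * (y′ * y′ ^ (M ℕ.+ M)) ∎)
      where
      open ≤-Reasoning
      y′ = 1ℚ - ½ * p
      c = ½ * ½ * (p * p)
      0≤y′ : 0ℚ ≤ y′
      0≤y′ = 1-2⁻-nonNeg (suc (suc i))
      0≤c : 0ℚ ≤ c
      0≤c = *-nonNeg {½ * ½} (≤ᵇ⇒≤ _) (*-nonNeg 0≤p 0≤p)
      M·p≡2-p : M · p ≡ (1ℚ + 1ℚ) - p
      M·p≡2-p = trans (solve 2 (λ x p → x := (p :+ x) :- p) refl (M · p) p)
        (cong (_- p) (trans (cong (_· p) 1+M≡2N) 2N·p≡2))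
      M·c≡ : M · c ≡ ½ * ½ * p * ((1ℚ + 1ℚ) - p)
      M·c≡ = trans (cong (M ·_) (sym (*-assoc (½ * ½) p p)))
        (trans (sym (×-comm-* M (½ * ½ * p) p)) (cong (½ * ½ * p *_) M·p≡2-p))
      gain : y′ * (y ^ M * (y + M · c)) ≡ y * y ^ M + y ^ M * (½ * ½ * ½ * (p * p * p))
      gain = trans (cong (λ z → y′ * (y ^ M * (y + z))) M·c≡)
        (solve 2 (λ p b →
            (con 1ℚ :- con ½ :* p) :* (b :* ((con 1ℚ :- p) :+ con (½ * ½) :* p :* (con (1ℚ + 1ℚ) :- p)))
            := (con 1ℚ :- p) :* b :+ b :* (con (½ * ½ * ½) :* (p :* p :* p)))
          refl p (y ^ M))

  ⅛ : ℚ
  ⅛ = ½ * ½ * ½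

  [1-p]^M≥⅛ : ∀ i M → suc M ≡ 2 ℕ.* 2 ℕ.^ suc i → ⅛ ≤ (1ℚ - 2⁻ suc i) ^ M
  [1-p]^M≥⅛ zero    .3 refl = ≤ᵇ⇒≤ _
  [1-p]^M≥⅛ (suc i) M 1+M≡ = subst (λ M → ⅛ ≤ (1ℚ - 2⁻ suc (suc i)) ^ M) M≡
    (≤-trans ([1-p]^M≥⅛ i M₀ 1+M₀≡) ([1-p]^M-doubling i M₀ 1+M₀≡))
    where
    M₀ = ℕ.pred (2 ℕ.* 2 ℕ.^ suc i)
    1+M₀≡ : suc M₀ ≡ 2 ℕ.* 2 ℕ.^ suc i
    1+M₀≡ = ℕₚ.suc-pred _ {{ℕₚ.m^n≢0 2 (suc (suc i))}}
    M≡ : suc (M₀ ℕ.+ M₀) ≡ M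
    M≡ = ℕₚ.suc-injective (trans (sym (cong suc (ℕₚ.+-suc M₀ M₀)))
           (trans (cong₂ ℕ._+_ 1+M₀≡ (trans 1+M₀≡ (sym (ℕₚ.+-identityʳ _)))) (sym 1+M≡)))

  -- The expectation of g(X) for a binomially distributed X with parameters k and p.
  binomial : ℚ → ℕ → (ℕ → ℚ) → ℚ
  binomial p zero    g = g 0
  binomial p (suc k) g = p * binomial p k (g ∘ suc) + (1ℚ - p) * binomial p k g

  binomial-const : ∀ p c k → binomial p k (λ _ → c) ≡ c
  binomial-const p c zero    = refl
  binomial-const p c (suc k) rewrite binomial-const p c k =
    solve 2 (λ p c → p :* c :+ (con 1ℚ :- p) :* c := c) refl p c

  isZero isOne isPositive : ℕ → ℚ
  isZero zero        = 1ℚ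
  isZero (suc _)     = 0ℚ
  isOne zero         = 0ℚ
  isOne (suc k)      = isZero k
  isPositive zero    = 0ℚ
  isPositive (suc _) = 1ℚ

  module _ (p : ℚ) where

    private
      y = 1ℚ - p

    binomial-isZero : ∀ k → binomial p k isZero ≡ y ^ k
    binomial-isZero zero    = refl
    binomial-isZero (suc k) rewrite binomial-const p 0ℚ k | binomial-isZero k =
      solve 2 (λ p b → p :* con 0ℚ :+ (con 1ℚ :- p) :* b := (con 1ℚ :- p) :* b) refl p (y ^ k)

    binomial-isPositive : ∀ k → binomial p k isPositive ≡ 1ℚ - y ^ k
    binomial-isPositive zero    = refl
    binomial-isPositive (suc k) rewrite binomial-const p 1ℚ k | binomial-isPositive k =
      solve 2 (λ p b → p :* con 1ℚ :+ (con 1ℚ :- p) :* (con 1ℚ :- b) := con 1ℚ :- (con 1ℚ :- p) :* b)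
        refl p (y ^ k)

    -- The usual `k p (1 - p)ᵏ⁻¹` multiplied by `1 - p`, which removes the exponent `k - 1`. The
    -- factor `y` is cancelled later, where it is positive.
    binomial-isOne : ∀ k → y * binomial p k isOne ≡ (k · p) * y ^ k
    binomial-isOne zero    = *-zeroʳ y
    binomial-isOne (suc k) = begin
      y * (p * binomial p k isZero + y * binomial p k isOne)
        ≡⟨ cong₂ (λ a b → y * (p * a + b)) (binomial-isZero k) (binomial-isOne k) ⟩
      y * (p * y ^ k + (k · p) * y ^ k)
        ≡⟨ solve 4 (λ y p a x → y :* (p :* a :+ x :* a) := (p :+ x) :* (y :* a)) refl y p (y ^ k) (k · p) ⟩
      (p + k · p) * (y * y ^ k) ∎
      where open ≡-Reasoning

  ·-mono-≤ : ∀ {x} → 0ℚ ≤ x → ∀ {j k} → j ℕ.≤ k → j · x ≤ k · x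
  ·-mono-≤ {x} 0≤x {j} j≤k with ℕₚ.m≤n⇒∃[o]m+o≡n j≤k
  ... | d , refl = ≤-by-difference (d · x) (·-nonNeg 0≤x d) (×-homo-+ x j d)

  module _ (i : ℕ) where

    private
      N = 2 ℕ.^ suc i
      p = 2⁻ suc i
      y = 1ℚ - p

      one : ℕ → ℚ
      one k = binomial p k isOne

      0≤p : 0ℚ ≤ p
      0≤p = 2⁻-nonNeg (suc i)

      0≤y : 0ℚ ≤ y
      0≤y = 1-2⁻-nonNeg (suc i)

      instance
        y-positive : ℚ.Positive y
        y-positive = positive (<-≤-trans (positive⁻¹ ½) (½≤1-2⁻1+i i))

      open ≤-Reasoning

      -- The ratio of the probabilities of one hit and of no hit is `k p / (1 - p)`, and it reaches
      -- 1 at `k = N - 1`.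
      y^k≤one : ∀ k → N ℕ.≤ suc k → y ^ k ≤ one k
      y^k≤one k N≤1+k = *-cancelˡ-≤-pos y (begin
        y * y ^ k         ≤⟨ *-monoʳ-≤ (^-nonNeg 0≤y k) y≤k·p ⟩
        (k · p) * y ^ k   ≡⟨ binomial-isOne p k ⟨
        y * one k         ∎)
        where
        1+k₀≡N : suc (ℕ.pred N) ≡ N
        1+k₀≡N = ℕₚ.suc-pred N {{ℕₚ.m^n≢0 2 (suc i)}}
        y≤k·p : y ≤ k · p
        y≤k·p = begin
          y                ≡⟨ [1+k]≡2^⇒k·p≡1-p i 1+k₀≡N ⟨
          ℕ.pred N · p     ≤⟨ ·-mono-≤ 0≤p (ℕₚ.≤-pred (subst (ℕ._≤ suc k) (sym 1+k₀≡N) N≤1+k)) ⟩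
          k · p            ∎

      -- One more trial replaces the probability of one hit by its weighted average with the
      -- probability of no hit, which is the smaller of the two in this range.
      one-antimono : ∀ k → N ℕ.≤ suc k → ∀ d → one (d ℕ.+ k) ≤ one k
      one-antimono k N≤1+k zero    = ≤-refl
      one-antimono k N≤1+k (suc d) = begin
        p * binomial p (d ℕ.+ k) isZero + y * one (d ℕ.+ k)
          ≡⟨ cong (λ z → p * z + y * one (d ℕ.+ k)) (binomial-isZero p (d ℕ.+ k)) ⟩
        p * y ^ (d ℕ.+ k) + y * one (d ℕ.+ k)
          ≤⟨ +-monoˡ-≤ _ (*-monoˡ-≤ 0≤p (y^k≤one (d ℕ.+ k) (ℕₚ.≤-trans N≤1+k (ℕ.s≤s (ℕₚ.m≤n+m k d))))) ⟩
        p * one (d ℕ.+ k) + y * one (d ℕ.+ k)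
          ≡⟨ solve 2 (λ p o → p :* o :+ (con 1ℚ :- p) :* o := o) refl p (one (d ℕ.+ k)) ⟩
        one (d ℕ.+ k)
          ≤⟨ one-antimono k N≤1+k d ⟩
        one k ∎

      -- At `k = 2 N - 2` the mean `k · p` is `2 y`, so the probability of one hit is `2 y ^ k`. The
      -- exponent is one below the `2 N - 1` of the bound by 1/8, which only helps.
      ¼≤one-max : ∀ k → suc (suc k) ≡ 2 ℕ.* N → ½ * ½ ≤ one k
      ¼≤one-max k 2+k≡2N = *-cancelˡ-≤-pos y (begin
        y * (½ * ½)
          ≡⟨ solve 1 (λ y → y :* con (½ * ½) := con (1ℚ + 1ℚ) :* y :* con ⅛) refl y ⟩
        (1ℚ + 1ℚ) * y * ⅛
          ≤⟨ *-monoˡ-≤ (*-nonNeg {1ℚ + 1ℚ} (≤ᵇ⇒≤ _) 0≤y) (≤-trans ([1-p]^M≥⅛ i (suc k) 2+k≡2N)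
               (^-antimono 0≤y (1-2⁻≤1 (suc i)) (ℕₚ.n≤1+n k))) ⟩
        (1ℚ + 1ℚ) * y * y ^ k
          ≡⟨ cong (_* y ^ k) k·p≡2y ⟨
        (k · p) * y ^ k
          ≡⟨ binomial-isOne p k ⟨
        y * one k ∎)
        where
        k·p≡2y : k · p ≡ (1ℚ + 1ℚ) * y
        k·p≡2y = trans (solve 2 (λ x p → x := (p :+ (p :+ x)) :- p :- p) refl (k · p) p)
          (trans (cong (λ z → z - p - p) (trans (cong (_· p) 2+k≡2N) (2N·p≡2 i)))
            (solve 1 (λ p → con (1ℚ + 1ℚ) :- p :- p := con (1ℚ + 1ℚ) :* (con 1ℚ :- p)) refl p))

    ¼≤binomial-isOne : ∀ k → N ℕ.≤ suc k → suc (suc k) ℕ.≤ 2 ℕ.* N → ½ * ½ ≤ binomial p k isOne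
    ¼≤binomial-isOne k N≤1+k 2+k≤2N with ℕₚ.m≤n⇒∃[o]m+o≡n 2+k≤2N
    ... | d , 2+k+d≡2N = ≤-trans
      (¼≤one-max (d ℕ.+ k) (trans (cong (λ z → suc (suc z)) (ℕₚ.+-comm d k)) 2+k+d≡2N))
      (one-antimono k N≤1+k d)

    ½≤binomial-isPositive : ∀ l → N ℕ.≤ suc l → ½ ≤ binomial p l isPositive
    ½≤binomial-isPositive l N≤1+l = subst (½ ≤_) (sym (binomial-isPositive p l))
      (+-monoʳ-≤ 1ℚ (neg-antimono-≤ ([1-p]^k≤½ i l N≤1+l)))

    ⅛≤isolation : ∀ k l → N ℕ.≤ suc k → suc (suc k) ℕ.≤ 2 ℕ.* N → k ℕ.≤ l →
                  ⅛ ≤ binomial p k isOne * binomial p l isPositive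
    ⅛≤isolation k l N≤1+k 2+k≤2N k≤l = ≤-trans
      (*-monoʳ-≤ 0≤½ ¼≤one)
      (*-monoˡ-≤ (≤-trans (≤ᵇ⇒≤ _) ¼≤one) (½≤binomial-isPositive l (ℕₚ.≤-trans N≤1+k (ℕ.s≤s k≤l))))
      where
      ¼≤one : ½ * ½ ≤ one k
      ¼≤one = ¼≤binomial-isOne k N≤1+k 2+k≤2N

  -- By induction on `k` the power is kept until the upper bound breaks; at that moment `k + 1`
  -- equals the next power of two exactly, so both bounds hold for it. The exponent `suc i` reflects
  -- that the sampling rates start at 1/2.
  ∃-scale : ∀ k → 1 ℕ.≤ k → ∃ λ i → 2 ℕ.^ suc i ℕ.≤ suc k × suc (suc k) ℕ.≤ 2 ℕ.* 2 ℕ.^ suc i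
  ∃-scale (suc zero)    _ = 0 , ℕₚ.≤-refl , ℕₚ.n≤1+n 3
  ∃-scale (suc (suc k)) _ with ∃-scale (suc k) (ℕ.s≤s ℕ.z≤n)
  ... | i , lower , upper with suc (suc (suc (suc k))) ℕₚ.≤? 2 ℕ.* 2 ℕ.^ suc i
  ...   | yes upper′ = i , ℕₚ.m≤n⇒m≤1+n lower , upper′
  ...   | no ≰       = suc i , ℕₚ.≤-reflexive (sym eq) , subst (λ z → suc z ℕ.≤ 2 ℕ.* N) (sym eq)
    (ℕₚ.m<m+n N (ℕₚ.≤-trans (ℕₚ.m^n>0 2 (suc (suc i))) (ℕₚ.m≤m+n N 0)))
    where
    N = 2 ℕ.^ suc (suc i)
    eq : suc (suc (suc k)) ≡ N
    eq = ℕₚ.≤-antisym upper (ℕₚ.≤-pred (ℕₚ.≰⇒> ≰))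

  -- The multiples are compared as unnormalised fractions, where `k / n` keeps its denominator and
  -- no common factor has to be cancelled.
  n·[1/n]≡1 : ∀ n .{{_ : ℕ.NonZero n}} → n · ((+ 1) ℚ./ n) ≡ 1ℚ
  n·[1/n]≡1 n@(suc n-1) = toℚᵘ-injective (ℚᵘₚ.≃-trans (multiple n) (ℚᵘ.*≡* (ℤₚ.*-comm (+ n) (+ 1))))
    where
    toℚᵘ-1/n : toℚᵘ ((+ 1) ℚ./ n) ℚᵘ.≃ ℚᵘ.mkℚᵘ (+ 1) n-1
    toℚᵘ-1/n = toℚᵘ-fromℚᵘ (ℚᵘ.mkℚᵘ (+ 1) n-1)
    multiple : ∀ k → toℚᵘ (k · ((+ 1) ℚ./ n)) ℚᵘ.≃ ℚᵘ.mkℚᵘ (+ k) n-1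
    multiple zero    = ℚᵘ.*≡* refl
    multiple (suc k) = ℚᵘₚ.≃-trans (toℚᵘ-homo-+ ((+ 1) ℚ./ n) (k · ((+ 1) ℚ./ n)))
      (ℚᵘₚ.≃-trans (ℚᵘₚ.+-cong toℚᵘ-1/n (multiple k)) (ℚᵘ.*≡*
        (trans (cong (ℤ._* (+ n)) (sym (ℤₚ.*-distribʳ-+ (+ n) (+ 1) (+ k))))
               (ℤₚ.*-assoc (+ suc k) (+ n) (+ n)))))

  ⅞ : ℚ
  ⅞ = 1ℚ - ⅛

  8^k·⅞^k≡7^k·1 : ∀ k → (8 ℕ.^ k) · (⅞ ^ k) ≡ (7 ℕ.^ k) · 1ℚ
  8^k·⅞^k≡7^k·1 zero    = refl
  8^k·⅞^k≡7^k·1 (suc k) = begin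
    (8 ℕ.* 8 ℕ.^ k) · (⅞ * ⅞ ^ k)     ≡⟨ ×-assocˡ (⅞ * ⅞ ^ k) 8 (8 ℕ.^ k) ⟨
    8 · ((8 ℕ.^ k) · (⅞ * ⅞ ^ k))     ≡⟨ cong (8 ·_) (×-comm-* (8 ℕ.^ k) ⅞ (⅞ ^ k)) ⟨
    -- `8 · ⅞` and `7 · 1ℚ` evaluate to the same rational, so the coefficient changes in the same
    -- step as the reassociation.
    8 · (⅞ * (8 ℕ.^ k) · (⅞ ^ k))     ≡⟨ ×-assoc-* 8 ⅞ ((8 ℕ.^ k) · (⅞ ^ k)) ⟨
    7 · 1ℚ * (8 ℕ.^ k) · (⅞ ^ k)      ≡⟨ cong (7 · 1ℚ *_) (8^k·⅞^k≡7^k·1 k) ⟩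
    7 · 1ℚ * (7 ℕ.^ k) · 1ℚ           ≡⟨ ×-assoc-* 7 1ℚ ((7 ℕ.^ k) · 1ℚ) ⟩
    7 · (1ℚ * (7 ℕ.^ k) · 1ℚ)         ≡⟨ cong (7 ·_) (*-identityˡ ((7 ℕ.^ k) · 1ℚ)) ⟩
    7 · ((7 ℕ.^ k) · 1ℚ)              ≡⟨ ×-assocˡ 1ℚ 7 (7 ℕ.^ k) ⟩
    (7 ℕ.^ suc k) · 1ℚ                ∎
    where open ≡-Reasoning

  ·-cancel-≤ : ∀ k .{{_ : ℕ.NonZero k}} {x y} → k · x ≤ k · y → x ≤ y
  ·-cancel-≤ k@(suc k-1) {x} {y} h = *-cancelˡ-≤-pos (k · 1ℚ) {{k·1-positive}} (subst₂ _≤_ (eq x) (eq y) h)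
    where
    k·1-positive : ℚ.Positive (k · 1ℚ)
    k·1-positive = pos+nonNeg⇒pos 1ℚ (k-1 · 1ℚ) {{nonNegative (·-nonNeg (≤ᵇ⇒≤ _) k-1)}}
    eq : ∀ z → k · z ≡ k · 1ℚ * z
    eq z = trans (cong (k ·_) (sym (*-identityˡ z))) (sym (×-assoc-* k 1ℚ z))

  ⅞^k≤1/n : ∀ n .{{_ : ℕ.NonZero n}} k → n ℕ.* 7 ℕ.^ k ℕ.≤ 8 ℕ.^ k → ⅞ ^ k ≤ (+ 1) ℚ./ n
  ⅞^k≤1/n n k h = ·-cancel-≤ n (·-cancel-≤ (7 ℕ.^ k) {{ℕₚ.m^n≢0 7 k}} (begin
    (7 ℕ.^ k) · (n · (⅞ ^ k))        ≡⟨ ×-assocˡ (⅞ ^ k) (7 ℕ.^ k) n ⟩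
    (7 ℕ.^ k ℕ.* n) · (⅞ ^ k)        ≡⟨ cong (_· (⅞ ^ k)) (ℕₚ.*-comm (7 ℕ.^ k) n) ⟩
    (n ℕ.* 7 ℕ.^ k) · (⅞ ^ k)        ≤⟨ ·-mono-≤ (^-nonNeg (≤ᵇ⇒≤ _) k) h ⟩
    (8 ℕ.^ k) · (⅞ ^ k)              ≡⟨ 8^k·⅞^k≡7^k·1 k ⟩
    (7 ℕ.^ k) · 1ℚ                   ≡⟨ cong ((7 ℕ.^ k) ·_) (n·[1/n]≡1 n) ⟨
    (7 ℕ.^ k) · (n · ((+ 1) ℚ./ n))  ∎))
    where open ≤-Reasoning

-- Expectation and running time of programs

module _ where

  open import Data.Rational.Base using (_+_; _*_; _-_; _≤_)
  open ℚₚ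
  open ≡ using (refl; sym; trans; cong₂; subst)
  open ℚSolver.+-*-Solver
  open Exp (CommutativeRing.commutativeSemiring +-*-commutativeRing) using (_^_)
  open RationalBounds

  private
    variable
      a b ℓ ℓ′ : Level
      A : Set a
      B : Set b

  𝔼 : Prog A → (A → ℚ) → ℚ
  𝔼 (return x)   g = g x
  𝔼 (charge _ q) g = 𝔼 q g
  𝔼 (draw i q)   g = 2⁻ i * 𝔼 (q true) g + (1ℚ - 2⁻ i) * 𝔼 (q false) g

  Pr≡𝔼 : (q : Prog A) {P : Pred A ℓ} (P? : Decidable P) →
         Pr q P? ≡ 𝔼 q (λ x → if does (P? x) then 1ℚ else 0ℚ)
  Pr≡𝔼 (return x)   P? = refl
  Pr≡𝔼 (charge _ q) P? = Pr≡𝔼 q P?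
  Pr≡𝔼 (draw i q)   P? =
    cong₂ (λ u v → 2⁻ i * u + (1ℚ - 2⁻ i) * v) (Pr≡𝔼 (q true) P?) (Pr≡𝔼 (q false) P?)

  𝔼->>= : (q : Prog A) (f : A → Prog B) (g : B → ℚ) → 𝔼 (q >>= f) g ≡ 𝔼 q (λ x → 𝔼 (f x) g)
  𝔼->>= (return x)   f g = refl
  𝔼->>= (charge _ q) f g = 𝔼->>= q f g
  𝔼->>= (draw i q)   f g =
    cong₂ (λ u v → 2⁻ i * u + (1ℚ - 2⁻ i) * v) (𝔼->>= (q true) f g) (𝔼->>= (q false) f g)

  𝔼-const : (q : Prog A) (r : ℚ) → 𝔼 q (λ _ → r) ≡ r
  𝔼-const (return x)   r = refl
  𝔼-const (charge _ q) r = 𝔼-const q r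
  𝔼-const (draw i q)   r rewrite 𝔼-const (q true) r | 𝔼-const (q false) r =
    solve 2 (λ p r → p :* r :+ (con 1ℚ :- p) :* r := r) refl (2⁻ i) r

  𝔼-complement : (q : Prog A) (g : A → ℚ) → 𝔼 q (λ x → 1ℚ - g x) ≡ 1ℚ - 𝔼 q g
  𝔼-complement (return x)   g = refl
  𝔼-complement (charge _ q) g = 𝔼-complement q g
  𝔼-complement (draw i q)   g rewrite 𝔼-complement (q true) g | 𝔼-complement (q false) g =
    solve 3 (λ p u v → p :* (con 1ℚ :- u) :+ (con 1ℚ :- p) :* (con 1ℚ :- v)
                       := con 1ℚ :- (p :* u :+ (con 1ℚ :- p) :* v))
      refl (2⁻ i) (𝔼 (q true) g) (𝔼 (q false) g)

  𝔼-*ˡ : (q : Prog A) (r : ℚ) (g : A → ℚ) → 𝔼 q (λ x → r * g x) ≡ r * 𝔼 q g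
  𝔼-*ˡ (return x)   r g = refl
  𝔼-*ˡ (charge _ q) r g = 𝔼-*ˡ q r g
  𝔼-*ˡ (draw i q)   r g rewrite 𝔼-*ˡ (q true) r g | 𝔼-*ˡ (q false) r g =
    solve 4 (λ p r u v → p :* (r :* u) :+ (con 1ℚ :- p) :* (r :* v)
                         := r :* (p :* u :+ (con 1ℚ :- p) :* v))
      refl (2⁻ i) r (𝔼 (q true) g) (𝔼 (q false) g)

  -- Asks for `P` at every leaf, whatever the probability of reaching it. Facts about the results of
  -- a program can thus be used under an expectation or in a worst-case time bound without
  -- conditioning.
  data Always {A : Set a} (P : Pred A ℓ) : Prog A → Set (a ⊔ ℓ) where
    return : ∀ {x} → P x → Always P (return x)
    charge : ∀ {k q} → Always P q → Always P (charge k q)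
    draw   : ∀ {i q} → (∀ t → Always P (q t)) → Always P (draw i q)

  always->>= : {P : Pred A ℓ} {Q : Pred B ℓ′} {q : Prog A} {f : A → Prog B} →
               Always P q → (∀ x → P x → Always Q (f x)) → Always Q (q >>= f)
  always->>= (return Px) h = h _ Px
  always->>= (charge p)  h = charge (always->>= p h)
  always->>= (draw p)    h = draw λ t → always->>= (p t) h

  always-⇒ : {P : Pred A ℓ} {Q : Pred A ℓ′} {q : Prog A} →
             (∀ x → P x → Q x) → Always P q → Always Q q
  always-⇒ h (return Px) = return (h _ Px)
  always-⇒ h (charge p)  = charge (always-⇒ h p)
  always-⇒ h (draw p)    = draw λ t → always-⇒ h (p t)

  always-true : {P : Pred A ℓ} (q : Prog A) → (∀ x → P x) → Always P q
  always-true (return x)   h = return (h x)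
  always-true (charge _ q) h = charge (always-true q h)
  always-true (draw _ q)   h = draw λ t → always-true (q t) h

  always-forEach : {P : Pred B ℓ} {body : A → B → Prog B} →
    (∀ xs → (∀ x → x ∈ₗ xs → ∀ s → P s → Always P (body x s)) →
     ∀ {s} → P s → Always P (forEach xs s body))
  always-forEach []       h Ps = return Ps
  always-forEach (x ∷ xs) h Ps =
    always->>= (h x (here refl) _ Ps) λ s → always-forEach xs (λ y y∈xs → h y (there y∈xs))

  -- `P` is carried up to the iteration at `t`, which establishes `Q`, and `Q` is carried from there
  -- on.
  always-forEach-∈ : {P Q : Pred B ℓ} {body : A → B → Prog B} {t : A} → ∀ xs → t ∈ₗ xs →
    (∀ x → x ∈ₗ xs → ∀ s → P s → Always P (body x s)) →
    (∀ x → x ∈ₗ xs → ∀ s → Q s → Always Q (body x s)) →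
    (∀ s → P s → Always Q (body t s)) →
    ∀ {s} → P s → Always Q (forEach xs s body)
  always-forEach-∈ (x ∷ xs) (here refl) keepP keepQ make Ps =
    always->>= (make _ Ps) λ s → always-forEach xs (λ y y∈xs → keepQ y (there y∈xs))
  always-forEach-∈ (x ∷ xs) (there t∈xs) keepP keepQ make Ps =
    always->>= (keepP x (here refl) _ Ps) λ s →
      always-forEach-∈ xs t∈xs (λ y y∈xs → keepP y (there y∈xs)) (λ y y∈xs → keepQ y (there y∈xs)) make

  𝔼-mono : {P : Pred A ℓ} {q : Prog A} {g h : A → ℚ} →
           Always P q → (∀ x → P x → g x ≤ h x) → 𝔼 q g ≤ 𝔼 q h
  𝔼-mono (return Px)      g≤h = g≤h _ Px
  𝔼-mono (charge p)       g≤h = 𝔼-mono p g≤h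
  𝔼-mono (draw {i = i} p) g≤h = +-mono-≤
    (*-monoˡ-≤ (2⁻-nonNeg i) (𝔼-mono (p true) g≤h))
    (*-monoˡ-≤ (1-2⁻-nonNeg i) (𝔼-mono (p false) g≤h))

  module _ {Inv : Pred B ℓ} {body : A → B → Prog B} (g : B → ℚ)
           (invariant : ∀ x s → Inv s → Always Inv (body x s)) where

    open ≤-Reasoning

    -- The substitute for independence of the iterations: the factor `r` is guaranteed from every
    -- state that satisfies `Inv`, hence conditionally on the whole past, and the tower property
    -- multiplies the factors.
    𝔼-forEach-^ : ∀ {r} → 0ℚ ≤ r → (∀ x s → Inv s → 𝔼 (body x s) g ≤ r * g s) →
                  ∀ xs s → Inv s → 𝔼 (forEach xs s body) g ≤ r ^ length xs * g s
    𝔼-forEach-^ 0≤r h []       s Is = ≤-reflexive (sym (*-identityˡ (g s)))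
    𝔼-forEach-^ {r} 0≤r h (x ∷ xs) s Is = begin
      𝔼 (body x s >>= λ s′ → forEach xs s′ body) g     ≡⟨ 𝔼->>= (body x s) _ g ⟩
      𝔼 (body x s) (λ s′ → 𝔼 (forEach xs s′ body) g)   ≤⟨ 𝔼-mono (invariant x s Is) (𝔼-forEach-^ 0≤r h xs) ⟩
      𝔼 (body x s) (λ s′ → r ^ length xs * g s′)       ≡⟨ 𝔼-*ˡ (body x s) (r ^ length xs) g ⟩
      r ^ length xs * 𝔼 (body x s) g                   ≤⟨ *-monoˡ-≤ (^-nonNeg 0≤r (length xs)) (h x s Is) ⟩
      r ^ length xs * (r * g s)                        ≡⟨ solve 3 (λ a r z → a :* (r :* z) := r :* a :* z) refl
                                                             (r ^ length xs) r (g s) ⟩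
      r * r ^ length xs * g s                          ∎

    𝔼-forEach-≤ : (∀ x s → Inv s → 𝔼 (body x s) g ≤ g s) →
                  ∀ xs s → Inv s → 𝔼 (forEach xs s body) g ≤ g s
    𝔼-forEach-≤ h []       s Is = ≤-refl
    𝔼-forEach-≤ h (x ∷ xs) s Is = begin
      𝔼 (body x s >>= λ s′ → forEach xs s′ body) g     ≡⟨ 𝔼->>= (body x s) _ g ⟩
      𝔼 (body x s) (λ s′ → 𝔼 (forEach xs s′ body) g)   ≤⟨ 𝔼-mono (invariant x s Is) (𝔼-forEach-≤ h xs) ⟩
      𝔼 (body x s) g                                   ≤⟨ h x s Is ⟩
      g s                                              ∎

    -- A single contracting iteration suffices when no other one raises the expectation. This
    -- singles out the right sampling rate among all rates tried.
    𝔼-forEach-∈ : ∀ {r x} → 0ℚ ≤ r → (∀ x s → Inv s → 𝔼 (body x s) g ≤ g s) →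
                  (∀ s → Inv s → 𝔼 (body x s) g ≤ r * g s) →
                  ∀ {xs} → x ∈ₗ xs → ∀ s → Inv s → 𝔼 (forEach xs s body) g ≤ r * g s
    𝔼-forEach-∈ {r} {x} 0≤r h hₓ {_ ∷ xs} (here refl) s Is = begin
      𝔼 (body x s >>= λ s′ → forEach xs s′ body) g     ≡⟨ 𝔼->>= (body x s) _ g ⟩
      𝔼 (body x s) (λ s′ → 𝔼 (forEach xs s′ body) g)   ≤⟨ 𝔼-mono (invariant x s Is) (𝔼-forEach-≤ h xs) ⟩
      𝔼 (body x s) g                                   ≤⟨ hₓ s Is ⟩
      r * g s                                          ∎
    𝔼-forEach-∈ {r} {x} 0≤r h hₓ {z ∷ xs} (there x∈xs) s Is = begin
      𝔼 (body z s >>= λ s′ → forEach xs s′ body) g     ≡⟨ 𝔼->>= (body z s) _ g ⟩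
      𝔼 (body z s) (λ s′ → 𝔼 (forEach xs s′ body) g)   ≤⟨ 𝔼-mono (invariant z s Is) (𝔼-forEach-∈ 0≤r h hₓ x∈xs) ⟩
      𝔼 (body z s) (λ s′ → r * g s′)                   ≡⟨ 𝔼-*ˡ (body z s) r g ⟩
      r * 𝔼 (body z s) g                               ≤⟨ *-monoˡ-≤ 0≤r (h z s Is) ⟩
      r * g s                                          ∎

  -- Worst-case time of sequences and loops

  time->>= : {P : Pred A ℓ} {q : Prog A} {f : A → Prog B} {k : ℕ} →
             Always P q → (∀ x → P x → time (f x) ℕ.≤ k) → time (q >>= f) ℕ.≤ time q ℕ.+ k
  time->>= (return Px) h = h _ Px
  time->>= {q = charge j q} {k = k} (charge p) h =
    ℕₚ.≤-trans (ℕₚ.+-monoʳ-≤ j (time->>= p h)) (ℕₚ.≤-reflexive (sym (ℕₚ.+-assoc j (time q) k)))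
  time->>= {q = draw i q} {k = k} (draw p) h =
    ℕₚ.≤-trans (ℕₚ.+-monoʳ-≤ i (ℕₚ.⊔-lub
      (ℕₚ.≤-trans (time->>= (p true) h) (ℕₚ.+-monoˡ-≤ k (ℕₚ.m≤m⊔n (time (q true)) (time (q false)))))
      (ℕₚ.≤-trans (time->>= (p false) h) (ℕₚ.+-monoˡ-≤ k (ℕₚ.m≤n⊔m (time (q true)) (time (q false)))))))
    (ℕₚ.≤-reflexive (sym (ℕₚ.+-assoc i (time (q true) ℕ.⊔ time (q false)) k)))

  time->>=-≤ : (q : Prog A) (f : A → Prog B) {j k : ℕ} →
               time q ℕ.≤ j → (∀ x → time (f x) ℕ.≤ k) → time (q >>= f) ℕ.≤ j ℕ.+ k
  time->>=-≤ q f q≤j f≤k = ℕₚ.≤-trans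
    (time->>= {P = λ _ → Unit {0ℓ}} (always-true q λ _ → tt) (λ x _ → f≤k x)) (ℕₚ.+-monoˡ-≤ _ q≤j)

  time-forEach : (body : A → B → Prog B) (k : A → ℕ) → (∀ x s → time (body x s) ℕ.≤ k x) →
                 ∀ xs s → time (forEach xs s body) ℕ.≤ foldr (λ x → k x ℕ.+_) 0 xs
  time-forEach body k h []       s = ℕ.z≤n
  time-forEach body k h (x ∷ xs) s =
    time->>=-≤ (body x s) _ (h x s) (λ s′ → time-forEach body k h xs s′)

  time-forEach-≤ : (body : A → B → Prog B) {k : ℕ} → ∀ xs → (∀ x → x ∈ₗ xs → ∀ s → time (body x s) ℕ.≤ k) →
                   ∀ s → time (forEach xs s body) ℕ.≤ length xs ℕ.* k
  time-forEach-≤ body []       h s = ℕ.z≤n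
  time-forEach-≤ body (x ∷ xs) h s = time->>=-≤ (body x s) _ (h x (here refl) s)
    (time-forEach-≤ body xs λ y y∈xs → h y (there y∈xs))

  time-forEach-range : (body : ℕ → B → Prog B) {k : ℕ} → ∀ N → (∀ i → i ℕ.≤ N → ∀ s → time (body i s) ℕ.≤ k) →
                       ∀ s → time (forEach (applyUpTo suc N) s body) ℕ.≤ N ℕ.* k
  time-forEach-range body {k} N h s = subst
    (λ l → time (forEach (applyUpTo suc N) s body) ℕ.≤ l ℕ.* k) (length-applyUpTo suc N)
    (time-forEach-≤ body (applyUpTo suc N) (λ i i∈ → h i (range i i∈)) s)
    where
    range : ∀ i → i ∈ₗ applyUpTo suc N → i ℕ.≤ N
    range i i∈ with ∈-applyUpTo⁻ suc i∈
    ... | _ , i<N , refl = i<N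

  -- Random samples of a terminal set

  sample-⊆ : ∀ {n} i (T : Subset n) → Always (_⊆ T) (sample i T)
  sample-⊆ i []            = return ⊆-refl
  sample-⊆ i (outside ∷ T) = charge (always->>= (sample-⊆ i T) λ _ R⊆T → return (s⊆s R⊆T))
  sample-⊆ i (inside ∷ T)  = charge (draw λ
    { true  → always->>= (sample-⊆ i T) λ _ R⊆T → return (s⊆s R⊆T)
    ; false → always->>= (sample-⊆ i T) λ _ R⊆T → return (out⊆ R⊆T) })

  -- The numbers of sampled elements inside and outside S are independent.
  𝔼-sample : ∀ {n} i (T S : Subset n) (g h : ℕ → ℚ) →
    𝔼 (sample i T) (λ R → (g ∣ R ∩ S ∣) * (h ∣ R ∩ ∁ S ∣))
    ≡ (binomial (2⁻ i) ∣ T ∩ S ∣ g) * (binomial (2⁻ i) ∣ T ∩ ∁ S ∣ h)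
  𝔼-sample i []            []            g h = refl
  𝔼-sample i (outside ∷ T) (s ∷ S)       g h = trans (𝔼->>= (sample i T) _ _) (𝔼-sample i T S g h)
  𝔼-sample i (inside ∷ T)  (inside ∷ S)  g h
    rewrite 𝔼->>= (sample i T) (λ R → return (inside ∷ R))
                  (λ R → (g ∣ R ∩ (inside ∷ S) ∣) * (h ∣ R ∩ ∁ (inside ∷ S) ∣))
          | 𝔼->>= (sample i T) (λ R → return (outside ∷ R))
                  (λ R → (g ∣ R ∩ (inside ∷ S) ∣) * (h ∣ R ∩ ∁ (inside ∷ S) ∣))
          | 𝔼-sample i T S (g ∘ suc) h | 𝔼-sample i T S g h =
    solve 4 (λ p u v w → p :* (u :* w) :+ (con 1ℚ :- p) :* (v :* w) := (p :* u :+ (con 1ℚ :- p) :* v) :* w)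
      refl (2⁻ i) (binomial (2⁻ i) ∣ T ∩ S ∣ (g ∘ suc)) (binomial (2⁻ i) ∣ T ∩ S ∣ g)
      (binomial (2⁻ i) ∣ T ∩ ∁ S ∣ h)
  𝔼-sample i (inside ∷ T)  (outside ∷ S) g h
    rewrite 𝔼->>= (sample i T) (λ R → return (inside ∷ R))
                  (λ R → (g ∣ R ∩ (outside ∷ S) ∣) * (h ∣ R ∩ ∁ (outside ∷ S) ∣))
          | 𝔼->>= (sample i T) (λ R → return (outside ∷ R))
                  (λ R → (g ∣ R ∩ (outside ∷ S) ∣) * (h ∣ R ∩ ∁ (outside ∷ S) ∣))
          | 𝔼-sample i T S g (h ∘ suc) | 𝔼-sample i T S g h =
    solve 4 (λ p u v w → p :* (w :* u) :+ (con 1ℚ :- p) :* (w :* v) := w :* (p :* u :+ (con 1ℚ :- p) :* v))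
      refl (2⁻ i) (binomial (2⁻ i) ∣ T ∩ ∁ S ∣ (h ∘ suc)) (binomial (2⁻ i) ∣ T ∩ ∁ S ∣ h)
      (binomial (2⁻ i) ∣ T ∩ S ∣ g)

  time-sample : ∀ {n} i (T : Subset n) → time (sample i T) ℕ.≤ n ℕ.* suc i
  time-sample         i []            = ℕ.z≤n
  time-sample {suc n} i (s ∷ T)       = helper s
    where
    extend : ∀ t → time (sample i T >>= λ R → return (t ∷ R)) ℕ.≤ n ℕ.* suc i
    extend t = ℕₚ.≤-trans (time->>= (sample-⊆ i T) (λ _ _ → ℕₚ.≤-refl))
      (ℕₚ.≤-trans (ℕₚ.≤-reflexive (ℕₚ.+-identityʳ _)) (time-sample i T))
    helper : ∀ s → time (sample i (s ∷ T)) ℕ.≤ suc n ℕ.* suc i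
    helper outside = ℕ.s≤s (ℕₚ.≤-trans (extend outside) (ℕₚ.m≤n+m _ i))
    helper inside  = ℕ.s≤s (ℕₚ.+-monoʳ-≤ i (ℕₚ.⊔-lub (extend inside) (extend outside)))

-- Finite sums, subsets and logarithms

module FiniteSum {a ℓ} (M : CommutativeMonoid a ℓ) where

  open CommutativeMonoid M renaming (refl to ≈-refl; sym to ≈-sym; trans to ≈-trans)
  open Sum M

  -- Loops over `elements` and `incident` become sums of guarded terms over all indices, whose order
  -- can be exchanged. The general monoid covers both uses: cut values in the field and step counts
  -- in `ℕ`.
  sum-filter-tabulate : ∀ {b p} {B : Set b} {P : Pred B p} (P? : Decidable P)
    (f : B → Carrier) {n} (g : Fin n → B) →
    foldr (λ x → f x ∙_) ε (filter P? (tabulate g)) ≈ sum (λ i → if does (P? (g i)) then f (g i) else ε)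
  sum-filter-tabulate P? f {zero}  g = ≈-refl
  sum-filter-tabulate P? f {suc n} g with does (P? (g zero))
  ... | true  = ∙-congˡ (sum-filter-tabulate P? f (g ∘ suc))
  ... | false = ≈-trans (sum-filter-tabulate P? f (g ∘ suc)) (≈-sym (identityˡ _))

  sum-filter : ∀ {n p} {P : Pred (Fin n) p} (P? : Decidable P) (f : Fin n → Carrier) →
    foldr (λ x → f x ∙_) ε (filter P? (allFin n)) ≈ sum (λ i → if does (P? i) then f i else ε)
  sum-filter P? f = sum-filter-tabulate P? f id

  sum-zero : ∀ {n} {f : Fin n → Carrier} → (∀ i → f i ≈ ε) → sum f ≈ ε
  sum-zero {n} h = ≈-trans (sum-cong-≋ h) (sum-replicate-zero n)

  sum-single : ∀ {n} {f : Fin n → Carrier} i → (∀ j → j ≢ i → f j ≈ ε) → sum f ≈ f i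
  sum-single zero    h = ≈-trans (∙-congˡ (sum-zero λ j → h (suc j) λ ())) (identityʳ _)
  sum-single (suc i) h = ≈-trans
    (∙-cong (h zero λ ()) (sum-single i λ j j≢i → h (suc j) (j≢i ∘ Finₚ.suc-injective))) (identityˡ _)

  if-sum : ∀ {n} b (f : Fin n → Carrier) →
           (if b then sum f else ε) ≈ sum (λ i → if b then f i else ε)
  if-sum true  f = ≈-refl
  if-sum {n} false f = ≈-sym (sum-replicate-zero n)

module _ where

  open import Data.Nat.Base using (_^_; _≤_)
  open ≡ using (refl; sym; trans; cong; subst)

  open FiniteSum ℕₚ.+-0-commutativeMonoid
  open Sum ℕₚ.+-0-commutativeMonoid using (sum)

  sum-mono-≤ : ∀ {n} {f g : Fin n → ℕ} → (∀ i → f i ≤ g i) → sum f ≤ sum g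
  sum-mono-≤ {zero}  h = z≤n
  sum-mono-≤ {suc n} h = ℕₚ.+-mono-≤ (h zero) (sum-mono-≤ (h ∘ suc))

  sum-const : ∀ n c → sum {n} (λ _ → c) ≡ n ℕ.* c
  sum-const zero    c = refl
  sum-const (suc n) c = cong (c ℕ.+_) (sum-const n c)

  -- Cardinalities of subsets

  ∣p∩q∣+∣p∩∁q∣≡∣p∣ : ∀ {n} (p q : Subset n) → ∣ p ∩ q ∣ ℕ.+ ∣ p ∩ ∁ q ∣ ≡ ∣ p ∣
  ∣p∩q∣+∣p∩∁q∣≡∣p∣ []            []            = refl
  ∣p∩q∣+∣p∩∁q∣≡∣p∣ (outside ∷ p) (_ ∷ q)       = ∣p∩q∣+∣p∩∁q∣≡∣p∣ p q
  ∣p∩q∣+∣p∩∁q∣≡∣p∣ (inside ∷ p)  (inside ∷ q)  = cong suc (∣p∩q∣+∣p∩∁q∣≡∣p∣ p q)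
  ∣p∩q∣+∣p∩∁q∣≡∣p∣ (inside ∷ p)  (outside ∷ q) =
    trans (ℕₚ.+-suc ∣ p ∩ q ∣ ∣ p ∩ ∁ q ∣) (cong suc (∣p∩q∣+∣p∩∁q∣≡∣p∣ p q))

  ∣p∣≡0⇒p≡⊥ : ∀ {n} (p : Subset n) → ∣ p ∣ ≡ 0 → p ≡ ⊥
  ∣p∣≡0⇒p≡⊥ []            _  = refl
  ∣p∣≡0⇒p≡⊥ (outside ∷ p) eq = cong (outside ∷_) (∣p∣≡0⇒p≡⊥ p eq)

  ∣p∣≡1⇒p≡⁅x⁆ : ∀ {n} (p : Subset n) → ∣ p ∣ ≡ 1 → ∃ λ x → p ≡ ⁅ x ⁆
  ∣p∣≡1⇒p≡⁅x⁆ (outside ∷ p) eq with ∣p∣≡1⇒p≡⁅x⁆ p eq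
  ... | x , p≡⁅x⁆ = suc x , cong (outside ∷_) p≡⁅x⁆
  ∣p∣≡1⇒p≡⁅x⁆ (inside ∷ p)  eq = zero , cong (inside ∷_) (∣p∣≡0⇒p≡⊥ p (ℕₚ.suc-injective eq))

  nonempty⇒1≤∣p∣ : ∀ {n} {p : Subset n} → Nonempty p → 1 ≤ ∣ p ∣
  nonempty⇒1≤∣p∣ {p = p} (x , x∈p) with ∣ p ∣ in eq
  ... | zero  = contradiction (subst (x ∈_) (∣p∣≡0⇒p≡⊥ p eq) x∈p) ∉⊥
  ... | suc _ = s≤s z≤n

  1≤∣p∣⇒nonempty : ∀ {n} {p : Subset n} → 1 ≤ ∣ p ∣ → Nonempty p
  1≤∣p∣⇒nonempty {n} {p} 1≤ with nonempty? p
  ... | yes ne = ne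
  ... | no ¬ne = contradiction (subst (λ q → 1 ≤ ∣ q ∣) (Empty-unique ¬ne) 1≤)
    (subst (λ k → ¬ 1 ≤ k) (sym (∣⊥∣≡0 n)) λ ())

  another-element : ∀ {n} {p : Subset n} x → 2 ≤ ∣ p ∣ → ∃ λ y → y ∈ p × y ≢ x
  another-element {p = p} x 2≤ with 1≤∣p∣⇒nonempty {p = p ∩ ∁ ⁅ x ⁆} 1≤∣p∖x∣
    where
    ∣p∩⁅x⁆∣≤1 : ∣ p ∩ ⁅ x ⁆ ∣ ≤ 1
    ∣p∩⁅x⁆∣≤1 = subst (∣ p ∩ ⁅ x ⁆ ∣ ≤_) (∣⁅x⁆∣≡1 x) (∣p∩q∣≤∣q∣ p ⁅ x ⁆)
    1≤∣p∖x∣ : 1 ≤ ∣ p ∩ ∁ ⁅ x ⁆ ∣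
    1≤∣p∖x∣ = ℕₚ.+-cancelˡ-≤ 1 _ _ (ℕₚ.≤-trans 2≤ (ℕₚ.≤-trans
      (ℕₚ.≤-reflexive (sym (∣p∩q∣+∣p∩∁q∣≡∣p∣ p ⁅ x ⁆))) (ℕₚ.+-monoˡ-≤ _ ∣p∩⁅x⁆∣≤1)))
  ... | y , y∈ with x∈p∩q⁻ p (∁ ⁅ x ⁆) y∈
  ...   | y∈p , y∈∁ = y , y∈p , λ { refl → x∈∁p⇒x∉p y∈∁ (x∈⁅x⁆ x) }

  -- Rounded logarithms

  n≤2^⌈log₂n⌉ : ∀ n → n ≤ 2 ^ ⌈log₂ n ⌉
  n≤2^⌈log₂n⌉ = <-rec _ step
    where
    step : ∀ n → (∀ {m} → m ℕ.< n → m ≤ 2 ^ ⌈log₂ m ⌉) → n ≤ 2 ^ ⌈log₂ n ⌉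
    step zero          _   = z≤n
    step (suc zero)    _   = ℕₚ.≤-refl
    step n@(suc (suc n′)) rec = begin
      n                                       ≡⟨ ℕₚ.⌊n/2⌋+⌈n/2⌉≡n n ⟨
      ⌊ n /2⌋ ℕ.+ ⌈ n /2⌉                     ≤⟨ ℕₚ.+-monoˡ-≤ ⌈ n /2⌉ (ℕₚ.⌊n/2⌋≤⌈n/2⌉ n) ⟩
      ⌈ n /2⌉ ℕ.+ ⌈ n /2⌉                     ≡⟨ cong (⌈ n /2⌉ ℕ.+_) (ℕₚ.+-identityʳ ⌈ n /2⌉) ⟨
      2 ℕ.* ⌈ n /2⌉                           ≤⟨ ℕₚ.*-monoʳ-≤ 2 (rec (ℕₚ.⌈n/2⌉<n n′)) ⟩
      2 ^ suc ⌈log₂ ⌈ n /2⌉ ⌉                 ≡⟨ cong (λ k → 2 ^ suc k) (⌈log₂⌈n/2⌉⌉≡⌈log₂n⌉∸1 n) ⟩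
      2 ^ suc (⌈log₂ n ⌉ ℕ.∸ 1)               ≡⟨ cong (2 ^_) (ℕₚ.m+[n∸m]≡n (⌈log₂⌉-mono-≤ {2} {n} (s≤s (s≤s z≤n)))) ⟩
      2 ^ ⌈log₂ n ⌉                           ∎
      where open ℕₚ.≤-Reasoning

  ⌈log₂n⌉≤n : ∀ n → ⌈log₂ n ⌉ ≤ n
  ⌈log₂n⌉≤n = <-rec _ step
    where
    step : ∀ n → (∀ {m} → m ℕ.< n → ⌈log₂ m ⌉ ≤ m) → ⌈log₂ n ⌉ ≤ n
    step zero          _   = z≤n
    step (suc zero)    _   = z≤n
    step n@(suc (suc n′)) rec = begin
      ⌈log₂ n ⌉                 ≤⟨ ℕₚ.m≤n+m∸n ⌈log₂ n ⌉ 1 ⟩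
      suc (⌈log₂ n ⌉ ℕ.∸ 1)     ≡⟨ cong suc (⌈log₂⌈n/2⌉⌉≡⌈log₂n⌉∸1 n) ⟨
      suc ⌈log₂ ⌈ n /2⌉ ⌉       ≤⟨ s≤s (rec (ℕₚ.⌈n/2⌉<n n′)) ⟩
      suc ⌈ n /2⌉               ≤⟨ ℕₚ.⌈n/2⌉<n n′ ⟩
      n                         ∎
      where open ℕₚ.≤-Reasoning

  ^-distribʳ-* : ∀ k m n → (m ℕ.* n) ^ k ≡ m ^ k ℕ.* n ^ k
  ^-distribʳ-* zero    m n = refl
  ^-distribʳ-* (suc k) m n = trans (cong (m ℕ.* n ℕ.*_) (^-distribʳ-* k m n))
    (ℕₚ.[m*n]*[o*p]≡[m*o]*[n*p] m n (m ^ k) (n ^ k))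

  -- `d` is the distance from the current candidate to some exponent known to work. While the fuel
  -- covers that distance, the search must stop there at the latest, so one witness yields both
  -- correctness and an upper bound.
  searchLog-correct : ∀ n fuel k d → d ≤ fuel → n ℕ.* 7 ^ (d ℕ.+ k) ≤ 8 ^ (d ℕ.+ k) →
    let r = searchLog₈⸝₇ n fuel k in n ℕ.* 7 ^ r ≤ 8 ^ r × r ≤ d ℕ.+ k
  searchLog-correct n zero       k zero    d≤fuel h = h , ℕₚ.≤-refl
  searchLog-correct n (suc fuel) k d       d≤fuel h with n ℕ.* 7 ^ k ℕₚ.≤? 8 ^ k
  ... | yes found rewrite dec-true (n ℕ.* 7 ^ k ℕₚ.≤? 8 ^ k) found = found , ℕₚ.m≤n+m k d
  searchLog-correct n (suc fuel) k zero    d≤fuel h | no ¬found = contradiction h ¬found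
  searchLog-correct n (suc fuel) k (suc d) (s≤s d≤fuel) h | no ¬found
    rewrite dec-false (n ℕ.* 7 ^ k ℕₚ.≤? 8 ^ k) ¬found =
    subst (λ s → n ℕ.* 7 ^ s ≤ 8 ^ s → n ℕ.* 7 ^ r ≤ 8 ^ r × r ≤ s) (ℕₚ.+-suc d k)
      (searchLog-correct n fuel (suc k) d d≤fuel) h
    where
    r = searchLog₈⸝₇ n fuel (suc k)

  -- 2 · 7⁶ ≤ 8⁶, so that log_{8/7} n ≤ 6 log₂ n.
  log₈⸝₇-correct : ∀ n → let J = ⌈log₈⸝₇ n ⌉ in n ℕ.* 7 ^ J ≤ 8 ^ J × J ≤ 6 ℕ.* ⌈log₂ n ⌉
  log₈⸝₇-correct n with searchLog-correct n (7 ℕ.* n) 0 (6 ℕ.* L)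
      -- The witness `6 L` lies within the fuel `7 n`, since `L ≤ n`.
      (ℕₚ.*-mono-≤ (ℕₚ.m≤m+n 6 1) (⌈log₂n⌉≤n n))
      (subst (λ k → n ℕ.* 7 ^ k ≤ 8 ^ k) (sym (ℕₚ.+-identityʳ (6 ℕ.* L))) bound)
    where
    L = ⌈log₂ n ⌉
    open ℕₚ.≤-Reasoning
    bound : n ℕ.* 7 ^ (6 ℕ.* L) ≤ 8 ^ (6 ℕ.* L)
    bound = begin
      n ℕ.* 7 ^ (6 ℕ.* L)         ≤⟨ ℕₚ.*-monoˡ-≤ _ (n≤2^⌈log₂n⌉ n) ⟩
      2 ^ L ℕ.* 7 ^ (6 ℕ.* L)     ≡⟨ cong (2 ^ L ℕ.*_) (ℕₚ.^-*-assoc 7 6 L) ⟨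
      2 ^ L ℕ.* (7 ^ 6) ^ L       ≡⟨ ^-distribʳ-* L 2 (7 ^ 6) ⟨
      (2 ℕ.* 7 ^ 6) ^ L           ≤⟨ ℕₚ.^-monoˡ-≤ L (ℕₚ.≤ᵇ⇒≤ (2 ℕ.* 7 ^ 6) (8 ^ 6) _) ⟩
      (8 ^ 6) ^ L                 ≡⟨ ℕₚ.^-*-assoc 8 6 L ⟩
      8 ^ (6 ℕ.* L)               ∎
  ... | correct , bounded = correct , subst (⌈log₈⸝₇ n ⌉ ≤_) (ℕₚ.+-identityʳ _) bounded

-- Ordered fields and the value of a cut

module OrderedField {c ℓ₁ ℓ₂} (K : ArchimedeanOrderedField c ℓ₁ ℓ₂) where

  open ArchimedeanOrderedField K public
  open IsDecTotalOrder isDecTotalOrder public using (antisym; total; ≤-respʳ-≈; ≤-respˡ-≈)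
    renaming (refl to ≤-refl; trans to ≤-trans; reflexive to ≤-reflexive)
  open RingProperties ring using (-‿distribˡ-*; -‿involutive)
  open Mult semiring using (×-assoc-*; ×1-homo-*; ×-congʳ)
  open Sum +-commutativeMonoid public using (sum-cong-≋; ∑-comm)
  open FiniteSum +-commutativeMonoid public

  ≤-resp₂ : ∀ {x x′ y y′} → x ≈ x′ → y ≈ y′ → x ≤ y → x′ ≤ y′
  ≤-resp₂ x≈x′ y≈y′ = ≤-respʳ-≈ y≈y′ ∘ ≤-respˡ-≈ x≈x′

  +-nonNegative : ∀ {x y} → 0# ≤ x → 0# ≤ y → 0# ≤ x + y
  +-nonNegative {x} 0≤x 0≤y = ≤-trans 0≤x (≤-respˡ-≈ (+-identityʳ x) (+-monoʳ-≤ x 0≤y))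

  x≤0⇒0≤-x : ∀ {x} → x ≤ 0# → 0# ≤ - x
  x≤0⇒0≤-x {x} x≤0 = ≤-resp₂ (-‿inverseˡ x) (+-identityʳ (- x)) (+-monoʳ-≤ (- x) x≤0)

  0≤-x⇒x≤0 : ∀ {x} → 0# ≤ - x → x ≤ 0#
  0≤-x⇒x≤0 {x} 0≤-x = ≤-resp₂ (+-identityʳ x) (-‿inverseʳ x) (+-monoʳ-≤ x 0≤-x)

  *-monoʳ : ∀ {x y z} → 0# ≤ z → x ≤ y → x * z ≤ y * z
  *-monoʳ {x} {y} {z} 0≤z x≤y = ≤-resp₂ (+-identityʳ (x * z)) eq (+-monoʳ-≤ (x * z) (*-nonNegative 0≤y-x 0≤z))
    where
    0≤y-x : 0# ≤ - x + y
    0≤y-x = ≤-respˡ-≈ (-‿inverseˡ x) (+-monoʳ-≤ (- x) x≤y)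
    eq : x * z + (- x + y) * z ≈ y * z
    eq = trans (sym (distribʳ z x (- x + y)))
      (*-congʳ (trans (sym (+-assoc x (- x) y)) (trans (+-congʳ (-‿inverseʳ x)) (+-identityˡ y))))

  *-monoˡ : ∀ {x y z} → 0# ≤ z → x ≤ y → z * x ≤ z * y
  *-monoˡ {x} {y} {z} 0≤z x≤y = ≤-resp₂ (*-comm x z) (*-comm y z) (*-monoʳ 0≤z x≤y)

  0≤1 : 0# ≤ 1#
  0≤1 with total 0# 1#
  ... | inj₁ 0≤1 = 0≤1
  ... | inj₂ 1≤0 = ≤-respʳ-≈
    (trans (sym (-‿distribˡ-* 1# (- 1#))) (trans (-‿cong (*-identityˡ (- 1#))) (-‿involutive 1#)))
    (*-nonNegative (x≤0⇒0≤-x 1≤0) (x≤0⇒0≤-x 1≤0))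

  1≰0 : ¬ 1# ≤ 0#
  1≰0 1≤0 = 0≉1 (antisym 0≤1 1≤0)

  ·-nonNegative : ∀ {x} → 0# ≤ x → ∀ k → 0# ≤ k · x
  ·-nonNegative 0≤x zero    = ≤-refl
  ·-nonNegative 0≤x (suc k) = +-nonNegative 0≤x (·-nonNegative 0≤x k)

  +-cancelˡ-≤ : ∀ z {x y} → z + x ≤ z + y → x ≤ y
  +-cancelˡ-≤ z {x} {y} h = ≤-resp₂ (eq x) (eq y) (+-monoʳ-≤ (- z) h)
    where
    eq : ∀ x → - z + (z + x) ≈ x
    eq x = trans (sym (+-assoc (- z) z x)) (trans (+-congʳ (-‿inverseˡ z)) (+-identityˡ x))

  ·1-cancel-≤ : ∀ j k → j · 1# ≤ k · 1# → j ℕ.≤ k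
  ·1-cancel-≤ zero    k       h = z≤n
  ·1-cancel-≤ (suc j) zero    h = contradiction
    (≤-trans (≤-respˡ-≈ (+-identityʳ 1#) (+-monoʳ-≤ 1# (·-nonNegative 0≤1 j))) h) 1≰0
  ·1-cancel-≤ (suc j) (suc k) h = s≤s (·1-cancel-≤ j k (+-cancelˡ-≤ 1# h))

  *-positive : ∀ {x y} → 0# < x → 0# < y → 0# < x * y
  *-positive {x} {y} (0≤x , 0≉x) (0≤y , 0≉y) = *-nonNegative 0≤x 0≤y , λ 0≈xy →
    let z , yz≈1 = inverse y (0≉y ∘ sym)
    in 0≉x (trans (sym (zeroˡ z)) (trans (*-congʳ 0≈xy)
         (trans (*-assoc x y z) (trans (*-congˡ yz≈1) (*-identityʳ x)))))

  -- A natural number above `1/x`, which the Archimedean axiom supplies, brings an inequality in the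
  -- field back to `ℕ`. With `x = ε³` it absorbs the dependence of the subroutine's cost on `ε` into
  -- a constant.
  ·-≤-scale : ∀ {x} → 0# < x → ∃ λ M → ∀ j k → j · x ≤ k · 1# → j ℕ.≤ k ℕ.* M
  ·-≤-scale {x} (0≤x , 0≉x) = M , bound
    where
    y = proj₁ (inverse x (0≉x ∘ sym))
    xy≈1 = proj₂ (inverse x (0≉x ∘ sym))
    M = proj₁ (archimedean y)
    y≤M = proj₂ (archimedean y)
    0≤y : 0# ≤ y
    0≤y with total 0# y
    ... | inj₁ 0≤y = 0≤y
    ... | inj₂ y≤0 = contradiction
      (0≤-x⇒x≤0 (≤-respʳ-≈
        (trans (*-comm x (- y)) (trans (sym (-‿distribˡ-* y x)) (-‿cong (trans (*-comm y x) xy≈1))))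
        (*-nonNegative 0≤x (x≤0⇒0≤-x y≤0)))) 1≰0
    bound : ∀ j k → j · x ≤ k · 1# → j ℕ.≤ k ℕ.* M
    bound j k h = ·1-cancel-≤ j (k ℕ.* M) (≤-resp₂
      (trans (×-assoc-* j x y) (×-congʳ j xy≈1))
      (sym (×1-homo-* k M))
      (≤-trans (*-monoʳ 0≤y h) (*-monoˡ (·-nonNegative 0≤1 k) y≤M)))

  -- Recursion on the membership of the first vertex; when both halves contain candidates, totality
  -- of the order picks the better of their two minima.
  minimum : ∀ {p n} {P : Pred (Subset n) p} (P? : Decidable P) (f : Subset n → Carrier) →
            ∃ P → ∃ (IsMinimum K P f)
  minimum {n = zero}  P? f ([] , P[]) = [] , P[] , λ { [] _ → ≤-refl }
  minimum {n = suc n} {P} P? f (S , PS)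
    with anySubset? (λ S → P? (inside ∷ S)) | anySubset? (λ S → P? (outside ∷ S))
  ... | no ∄in | no ∄out = contradiction {A = ∃ P} (S , PS) λ
    { (inside ∷ S , PS) → ∄in (S , PS) ; (outside ∷ S , PS) → ∄out (S , PS) }
  ... | yes ∃in | no ∄out with minimum (λ S → P? (inside ∷ S)) (f ∘ (inside ∷_)) ∃in
  ...   | S* , PS* , min = inside ∷ S* , PS* , λ
    { (inside ∷ S) PS → min S PS ; (outside ∷ S) PS → contradiction (S , PS) ∄out }
  minimum {n = suc n} {P} P? f (S , PS) | no ∄in | yes ∃out
    with minimum (λ S → P? (outside ∷ S)) (f ∘ (outside ∷_)) ∃out
  ...   | S* , PS* , min = outside ∷ S* , PS* , λ
    { (outside ∷ S) PS → min S PS ; (inside ∷ S) PS → contradiction (S , PS) ∄in }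
  minimum {n = suc n} {P} P? f (S , PS) | yes ∃in | yes ∃out
    with minimum (λ S → P? (inside ∷ S)) (f ∘ (inside ∷_)) ∃in
       | minimum (λ S → P? (outside ∷ S)) (f ∘ (outside ∷_)) ∃out
  ... | S₁ , PS₁ , min₁ | S₂ , PS₂ , min₂ with total (f (inside ∷ S₁)) (f (outside ∷ S₂))
  ...   | inj₁ ≤₂ = inside ∷ S₁ , PS₁ , λ
    { (inside ∷ S) PS → min₁ S PS ; (outside ∷ S) PS → ≤-trans ≤₂ (min₂ S PS) }
  ...   | inj₂ ≤₁ = outside ∷ S₂ , PS₂ , λ
    { (inside ∷ S) PS → ≤-trans ≤₁ (min₁ S PS) ; (outside ∷ S) PS → min₂ S PS }

  module CutValue {ε : Carrier} (A : IsolatingCuts K ε) {n m : ℕ} (G : Graph K n m) where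

    open Graph G

    contribution : Subset n → Fin m → Carrier
    contribution S e = if crosses S e then weight e else 0#

    δ-∁ : ∀ S → δ (∁ S) ≈ δ S
    δ-∁ S = sum-cong-≋ λ e → reflexive (≡.cong (λ b → if b then weight e else 0#) (crosses-∁ e))
      where
      not-xor-not : ∀ a b → not a xor not b ≡ a xor b
      not-xor-not true  true  = ≡.refl
      not-xor-not true  false = ≡.refl
      not-xor-not false true  = ≡.refl
      not-xor-not false false = ≡.refl
      crosses-∁ : ∀ e → crosses (∁ S) e ≡ crosses S e
      crosses-∁ e = ≡.trans (≡.cong₂ _xor_ (lookup-map (src e) not S) (lookup-map (tgt e) not S))
                            (not-xor-not (lookup S (src e)) (lookup S (tgt e)))

    always-accumulate : ∀ {b} {B : Set b} {body : B → Carrier → Prog Carrier} (f : B → Carrier) →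
      (∀ x s → Always (_≈ s + f x) (body x s)) →
      ∀ xs s → Always (_≈ s + foldr (λ x z → f x + z) 0# xs) (forEach xs s body)
    always-accumulate f h []       s = return (sym (+-identityʳ s))
    always-accumulate f h (x ∷ xs) s = always->>= (h x s) λ s′ s′≈ →
      always-⇒ (λ z z≈ → trans z≈ (trans (+-congʳ s′≈) (+-assoc s (f x) _))) (always-accumulate f h xs s′)

    incident? : ∀ v e → _
    incident? v e = (v Finₚ.≟ src e) ⊎-dec (v Finₚ.≟ tgt e)

    atEndpoint : Subset n → Carrier → Fin n → Fin m → Carrier
    atEndpoint S x v e = if does (v ∈? S) then (if does (incident? v e) then x else 0#) else 0#

    atEndpoint-zero : ∀ S v e → atEndpoint S 0# v e ≈ 0#
    atEndpoint-zero S v e with does (v ∈? S) | does (incident? v e)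
    ... | true  | true  = refl
    ... | true  | false = refl
    ... | false | _     = refl

    sum-single-endpoint : ∀ {S e x} u → u ∈ S → u ≡ src e ⊎ u ≡ tgt e →
      (∀ v → v ≢ u → v ∈ S → v ≢ src e × v ≢ tgt e) → sum (λ v → atEndpoint S x v e) ≈ x
    sum-single-endpoint {S} {e} {x} u u∈S u∈e unique = trans (sum-single u others)
      (reflexive (≡.cong₂ (λ a b → if a then (if b then x else 0#) else 0#)
        (dec-true (u ∈? S) u∈S) (dec-true (incident? u e) u∈e)))
      where
      others : ∀ v → v ≢ u → atEndpoint S x v e ≈ 0#
      others v v≢u with v ∈? S
      ... | no  _   = refl
      ... | yes v∈S = reflexive (≡.cong (if_then x else 0#) (dec-false (incident? v e)
        [ proj₁ (unique v v≢u v∈S) , proj₂ (unique v v≢u v∈S) ]′))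

    -- An edge that crosses S has exactly one endpoint in S.
    sum-endpoints : ∀ S e → sum (λ v → atEndpoint S (contribution S e) v e) ≈ contribution S e
    sum-endpoints S e with lookup S (src e) in src≡ | lookup S (tgt e) in tgt≡
    ... | true  | true  = sum-zero λ v → atEndpoint-zero S v e
    ... | false | false = sum-zero λ v → atEndpoint-zero S v e
    ... | true  | false = sum-single-endpoint (src e) (lookup⇒[]= (src e) S src≡) (inj₁ ≡.refl)
      λ v v≢src v∈S → v≢src ,
        λ { ≡.refl → contradiction (≡.trans (≡.sym tgt≡) ([]=⇒lookup v∈S)) λ () }
    ... | false | true  = sum-single-endpoint (tgt e) (lookup⇒[]= (tgt e) S tgt≡) (inj₂ ≡.refl)
      λ v v≢tgt v∈S →
        (λ { ≡.refl → contradiction (≡.trans (≡.sym src≡) ([]=⇒lookup v∈S)) λ () }) , v≢tgt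

    -- The scan meets an edge once for each endpoint in `S`. Exchanging the sums over vertices and
    -- edges, a crossing edge is counted once, and an edge inside `S` adds zero both times.
    cutValue-correct : ∀ S → Always (_≈ δ S) (cutValue K A G S)
    cutValue-correct S = always-⇒ (λ x x≈ → trans x≈ (trans (+-identityˡ _) total≈δ))
      (always-accumulate degree
        (λ v x → charge (always-accumulate (contribution S) step (incident v) x)) (elements S) 0#)
      where
      degree : Fin n → Carrier
      degree v = foldr (λ e z → contribution S e + z) 0# (incident v)
      step : ∀ e y → Always (_≈ y + contribution S e)
                            (charge 1 (return (if crosses S e then y + weight e else y)))
      step e y with crosses S e
      ... | true  = charge (return refl)
      ... | false = charge (return (sym (+-identityʳ y)))
      if-cong : ∀ b {x y} → x ≈ y → (if b then x else 0#) ≈ (if b then y else 0#)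
      if-cong true  x≈y = x≈y
      if-cong false x≈y = refl
      total≈δ : foldr (λ v z → degree v + z) 0# (elements S) ≈ δ S
      total≈δ = trans (sum-filter (_∈? S) degree)
        (trans (sum-cong-≋ λ v → trans
                 (if-cong (does (v ∈? S)) (sum-filter (incident? v) (contribution S)))
                 (if-sum (does (v ∈? S)) λ e → if does (incident? v e) then contribution S e else 0#))
        (trans (∑-comm λ v e → atEndpoint S (contribution S e) v e) (sum-cong-≋ (sum-endpoints S))))

-- Success probability

steinerCut-∁ : ∀ {n} {T S : Subset n} → SteinerCut T S → SteinerCut T (∁ S)
steinerCut-∁ {T = T} {S}
  (((_ , x , x∈S , _) , (_ , y , _ , y∉S)) , ((_ , t , t∈S∩T , _) , (_ , u , u∈T , u∉S∩T))) =
  ((⊥⊆ , y , x∉p⇒x∈∁p y∉S , ∉⊥) , (⊆⊤ , x , ∈⊤ , x∈p⇒x∉∁p x∈S)) ,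
  ((⊥⊆ , u , x∈p∩q⁺ (x∉p⇒x∈∁p (λ u∈S → u∉S∩T (x∈p∩q⁺ (u∈S , u∈T))) , u∈T) , ∉⊥) ,
   (p∩q⊆q (∁ S) T , t , proj₂ t∈ , λ t∈∁S∩T → x∈p⇒x∉∁p (proj₁ t∈) (proj₁ (x∈p∩q⁻ (∁ S) T t∈∁S∩T))))
  where
  t∈ = x∈p∩q⁻ S T t∈S∩T

singleton-steinerCut : ∀ {n} {T : Subset n} → 2 ℕ.≤ ∣ T ∣ → ∃ (SteinerCut T)
singleton-steinerCut {T = T} 2≤∣T∣ with 1≤∣p∣⇒nonempty {p = T} (ℕₚ.≤-trans (s≤s z≤n) 2≤∣T∣)
... | t , t∈T with another-element {p = T} t 2≤∣T∣
...   | u , u∈T , u≢t = ⁅ t ⁆ ,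
  ((⊥⊆ , t , x∈⁅x⁆ t , ∉⊥) , (⊆⊤ , u , ∈⊤ , x≢y⇒x∉⁅y⁆ u≢t)) ,
  ((⊥⊆ , t , x∈p∩q⁺ (x∈⁅x⁆ t , t∈T) , ∉⊥) ,
   (p∩q⊆q ⁅ t ⁆ T , u , u∈T , x≢y⇒x∉⁅y⁆ u≢t ∘ proj₁ ∘ x∈p∩q⁻ ⁅ t ⁆ T))

-- The cut separates `t` from a second sampled terminal, which exists because `R` has at least two
-- elements.
isolatingCut⇒steinerCut : ∀ {n} {T R S : Subset n} {t} →
  R ⊆ T → 2 ℕ.≤ ∣ R ∣ → IsolatingCut R t S → SteinerCut T S
isolatingCut⇒steinerCut {T = T} {R} {S} {t} R⊆T 2≤∣R∣ (proper , R∩S≡⁅t⁆) with another-element {p = R} t 2≤∣R∣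
... | u , u∈R , u≢t = proper ,
  ((⊥⊆ , t , x∈p∩q⁺ (proj₂ t∈ , R⊆T (proj₁ t∈)) , ∉⊥) ,
   (p∩q⊆q S T , u , R⊆T u∈R , λ u∈S∩T → u≢t (x∈⁅y⁆⇒x≡y t
     (≡.subst (u ∈_) R∩S≡⁅t⁆ (x∈p∩q⁺ (u∈R , proj₁ (x∈p∩q⁻ S T u∈S∩T)))))))
  where
  t∈ = x∈p∩q⁻ R S (≡.subst (t ∈_) (≡.sym R∩S≡⁅t⁆) (x∈⁅x⁆ t))

∈-elements : ∀ {n} {S : Subset n} {v} → v ∈ S → v ∈ₗ elements S
∈-elements {S = S} {v} v∈S = ∈-filter⁺ (_∈? S) (∈-allFin v) v∈S

∈-elements⁻ : ∀ {n} {S : Subset n} {v} → v ∈ₗ elements S → v ∈ S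
∈-elements⁻ {n} {S} v∈ = proj₂ (∈-filter⁻ (_∈? S) {xs = allFin n} v∈)

module Correctness {c ℓ₁ ℓ₂} (K : ArchimedeanOrderedField c ℓ₁ ℓ₂) where

  open OrderedField K
  open RationalBounds using (^-nonNeg; binomial; isOne; isPositive; ⅛≤isolation; ∃-scale; ⅞; ⅞^k≤1/n)
  open Exp (CommutativeRing.commutativeSemiring ℚₚ.+-*-commutativeRing) using (_^_)

  module _ {ε : Carrier} (0<ε : 0# < ε) (A : IsolatingCuts K ε)
           {n m : ℕ} (G : Graph K n m) (T : Subset n) (2≤∣T∣ : 2 ℕ.≤ ∣ T ∣) where

    open CutValue A G
    open Graph G using (δ)
    open IsolatingCuts A

    -- Both the value and the Steiner property are invariant under complement, so the side with
    -- fewer terminals may be taken.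
    smallMinimum : ∃ λ S → IsMinimum K (SteinerCut T) δ S × ∣ T ∩ S ∣ ℕ.≤ ∣ T ∩ ∁ S ∣
    smallMinimum with minimum (steinerCut? T) δ (singleton-steinerCut {T = T} 2≤∣T∣)
    ... | S , steiner , min with ℕₚ.≤-total (∣ T ∩ S ∣) (∣ T ∩ ∁ S ∣)
    ...   | inj₁ small = S , (steiner , min) , small
    ...   | inj₂ large = ∁ S ,
      (steinerCut-∁ {T = T} {S} steiner , λ S′ PS′ → ≤-respˡ-≈ (sym (δ-∁ S)) (min S′ PS′)) ,
      ≡.subst (λ S′ → ∣ T ∩ ∁ S ∣ ℕ.≤ ∣ T ∩ S′ ∣) (≡.sym (¬-involutive S)) large
      where open BooleanAlgebra (∪-∩-booleanAlgebra n) using (¬-involutive)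

    module Search (S* : Subset n) (S*-minimum : IsMinimum K (SteinerCut T) δ S*)
                  (S*-small : ∣ T ∩ S* ∣ ℕ.≤ ∣ T ∩ ∁ S* ∣)
                  (i* : ℕ) (i*-lower : 2 ℕ.^ suc i* ℕ.≤ suc ∣ T ∩ S* ∣)
                  (i*-upper : suc (suc ∣ T ∩ S* ∣) ℕ.≤ 2 ℕ.* 2 ℕ.^ suc i*) where

      bound : Carrier
      bound = (1# + ε) * δ S*

      0≤1+ε : 0# ≤ 1# + ε
      0≤1+ε = +-nonNegative 0≤1 (proj₁ 0<ε)

      -- `Good` speaks only of the stored number, which is all that comparisons look at; `Valid`
      -- ties that number to an actual Steiner cut. The initial `nothing` is valid, being vacuous,
      -- but not good.
      Valid Good : Pred (Best K A G) _
      Valid = All (λ (x , S) → x ≈ δ S × SteinerCut T S)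
      Good  = Any (λ (x , _) → x ≤ bound)

      good? : Decidable Good
      good? = dec (λ (x , _) → x ≤? bound)

      better-valid : ∀ {S x} b → x ≈ δ S → SteinerCut T S → Valid b → Valid (better K A G S x b)
      better-valid nothing x≈ steiner _ = just (x≈ , steiner)
      better-valid {S} {x} (just (y , S′)) x≈ steiner valid with y ≤? x
      ... | yes _ = valid
      ... | no  _ = just (x≈ , steiner)

      better-good : ∀ {S x} b → Good b → Good (better K A G S x b)
      better-good {S} {x} (just (y , S′)) (just y≤) with y ≤? x
      ... | yes _ = just y≤
      ... | no y≰x with total x y
      ...   | inj₁ x≤y = just (≤-trans x≤y y≤)
      ...   | inj₂ y≤x = contradiction y≤x y≰x

      better-makes-good : ∀ {S x} b → x ≤ bound → Good (better K A G S x b)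
      better-makes-good nothing x≤ = just x≤
      better-makes-good {S} {x} (just (y , S′)) x≤ with y ≤? x
      ... | yes y≤x = just (≤-trans y≤x x≤)
      ... | no  _   = just x≤

      -- What `round` does after drawing its sample: `round K A G T i b` unfolds to `sample i T`
      -- followed by this.
      process : Subset n → Best K A G → Prog (Best K A G)
      process R b = charge n (
        if does (2 ℕₚ.≤? ∣ R ∣)
        then charge (cost G R) (forEach (elements R) b λ t b′ → charge 1 (improve K A G (cuts G R t) b′))
        else return b)

      process-valid : ∀ {R} → R ⊆ T → ∀ b → Valid b → Always Valid (process R b)
      process-valid {R} R⊆T b valid with 2 ℕₚ.≤? ∣ R ∣
      ... | no 2≰ rewrite dec-false (2 ℕₚ.≤? ∣ R ∣) 2≰ = charge (return valid)
      ... | yes 2≤ rewrite dec-true (2 ℕₚ.≤? ∣ R ∣) 2≤ = charge (charge (always-forEach (elements R) step valid))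
        where
        step : ∀ t → t ∈ₗ elements R → ∀ b → Valid b → Always Valid (charge 1 (improve K A G (cuts G R t) b))
        step t t∈ b valid = charge (always->>= (cutValue-correct (cuts G R t)) λ x x≈ →
          charge (return (better-valid b x≈ (isolatingCut⇒steinerCut {S = cuts G R t} R⊆T 2≤
            (proj₁ (approximate G R 2≤ t (∈-elements⁻ t∈)))) valid)))

      improve-good : ∀ S b → Good b → Always Good (charge 1 (improve K A G S b))
      improve-good S b good = charge (always->>= (cutValue-correct S) λ x _ → charge (return (better-good b good)))

      process-good : ∀ R b → Good b → Always Good (process R b)
      process-good R b good with 2 ℕₚ.≤? ∣ R ∣
      ... | no 2≰ rewrite dec-false (2 ℕₚ.≤? ∣ R ∣) 2≰ = charge (return good)
      ... | yes 2≤ rewrite dec-true (2 ℕₚ.≤? ∣ R ∣) 2≤ =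
        charge (charge (always-forEach (elements R) (λ t _ → improve-good (cuts G R t)) good))

      isolated⇒2≤∣R∣ : ∀ R → ∣ R ∩ S* ∣ ≡ 1 → 1 ℕ.≤ ∣ R ∩ ∁ S* ∣ → 2 ℕ.≤ ∣ R ∣
      isolated⇒2≤∣R∣ R one outer = ≡.subst (2 ℕ.≤_) (∣p∩q∣+∣p∩∁q∣≡∣p∣ R S*)
        (ℕₚ.+-mono-≤ (ℕₚ.≤-reflexive (≡.sym one)) outer)

      -- If R meets S* in a single terminal t, then S* is an isolating cut for t.
      process-makes-good : ∀ {R} → ∣ R ∩ S* ∣ ≡ 1 → 1 ℕ.≤ ∣ R ∩ ∁ S* ∣ → ∀ b → Always Good (process R b)
      process-makes-good {R} one outer b with ∣p∣≡1⇒p≡⁅x⁆ (R ∩ S*) one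
      ... | t , R∩S*≡⁅t⁆ rewrite dec-true (2 ℕₚ.≤? ∣ R ∣) (isolated⇒2≤∣R∣ R one outer) =
        charge (charge (always-forEach-∈ {P = λ _ → Unit} (elements R) (∈-elements t∈R)
          (λ t _ b _ → always-true (charge 1 (improve K A G (cuts G R t) b)) (λ _ → tt))
          (λ t _ → improve-good (cuts G R t)) make tt))
        where
        2≤ : 2 ℕ.≤ ∣ R ∣
        2≤ = isolated⇒2≤∣R∣ R one outer
        t∈R : t ∈ R
        t∈R = proj₁ (x∈p∩q⁻ R S* (≡.subst (t ∈_) (≡.sym R∩S*≡⁅t⁆) (x∈⁅x⁆ t)))
        δ≤bound : δ (cuts G R t) ≤ bound
        δ≤bound with approximate G R 2≤ t t∈R
        ... | _ , S′ , (_ , min′) , δ≤ =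
          -- `S*` competes among the isolating cuts for `t`, so their minimum value is at most
          -- `δ S*`.
          ≤-trans δ≤ (*-monoˡ 0≤1+ε (min′ S* (proj₁ (proj₁ S*-minimum) , R∩S*≡⁅t⁆)))
        make : ∀ b → _ → Always Good (charge 1 (improve K A G (cuts G R t) b))
        make b _ = charge (always->>= (cutValue-correct (cuts G R t)) λ x x≈ →
          charge (return (better-makes-good b (≤-respˡ-≈ (sym x≈) δ≤bound))))

      bad : Best K A G → ℚ
      bad b = if does (good? b) then 0ℚ else 1ℚ

      good⇒bad≡0 : ∀ b → Good b → bad b ≡ 0ℚ
      good⇒bad≡0 b good = ≡.cong (λ t → if t then 0ℚ else 1ℚ) (dec-true (good? b) good)

      bad≤1 : ∀ b → bad b ℚ.≤ 1ℚ
      bad≤1 b with does (good? b)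
      ... | true  = ℚₚ.≤ᵇ⇒≤ _
      ... | false = ℚₚ.≤-refl

      𝔼-bad≤1 : ∀ q → 𝔼 q bad ℚ.≤ 1ℚ
      𝔼-bad≤1 q = ℚₚ.≤-trans
        (𝔼-mono (always-true {P = λ b → bad b ℚ.≤ 1ℚ} q bad≤1) (λ _ h → h))
        (ℚₚ.≤-reflexive (𝔼-const q 1ℚ))

      𝔼-bad≤0 : ∀ {q} → Always Good q → 𝔼 q bad ℚ.≤ 0ℚ
      𝔼-bad≤0 {q} always = ℚₚ.≤-trans
        (𝔼-mono always (λ b good → ℚₚ.≤-reflexive (good⇒bad≡0 b good)))
        (ℚₚ.≤-reflexive (𝔼-const q 0ℚ))

      round-valid : ∀ i b → Valid b → Always Valid (round K A G T i b)
      round-valid i b valid = always->>= (sample-⊆ i T) λ R R⊆T → process-valid R⊆T b valid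

      -- A good state stays good, so both sides vanish; from a bad state the right side is already
      -- the trivial bound 1.
      round-bad : ∀ i b → 𝔼 (round K A G T i b) bad ℚ.≤ bad b
      round-bad i b with good? b
      ... | yes good = 𝔼-bad≤0 (always->>= (sample-⊆ i T) λ R _ → process-good R b good)
      ... | no  _    = 𝔼-bad≤1 (round K A G T i b)

      isolated : Subset n → ℚ
      isolated R = (isOne ∣ R ∩ S* ∣) ℚ.* (isPositive ∣ R ∩ ∁ S* ∣)

      process-bad : ∀ b R → 𝔼 (process R b) bad ℚ.≤ 1ℚ ℚ.- isolated R
      process-bad b R with ∣ R ∩ S* ∣ in one | ∣ R ∩ ∁ S* ∣ in outer
      ... | 0           | l     = ℚₚ.≤-trans (𝔼-bad≤1 (process R b))
        (ℚₚ.≤-reflexive (≡.cong (λ z → 1ℚ ℚ.- z) (≡.sym (ℚₚ.*-zeroˡ (isPositive l)))))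
      ... | 1           | 0     = 𝔼-bad≤1 (process R b)
      ... | 1           | suc l = 𝔼-bad≤0
        (process-makes-good {R} one (≡.subst (1 ℕ.≤_) (≡.sym outer) (s≤s z≤n)) b)
      ... | suc (suc k) | l     = ℚₚ.≤-trans (𝔼-bad≤1 (process R b))
        (ℚₚ.≤-reflexive (≡.cong (λ z → 1ℚ ℚ.- z) (≡.sym (ℚₚ.*-zeroˡ (isPositive l)))))

      round-i*-bad : ∀ b → 𝔼 (round K A G T (suc i*) b) bad ℚ.≤ ⅞ ℚ.* bad b
      round-i*-bad b with good? b
      ... | yes good = 𝔼-bad≤0 (always->>= (sample-⊆ (suc i*) T) λ R _ → process-good R b good)
      ... | no  _    = begin
        𝔼 (sample (suc i*) T >>= λ R → process R b) bad
          ≡⟨ 𝔼->>= (sample (suc i*) T) _ bad ⟩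
        𝔼 (sample (suc i*) T) (λ R → 𝔼 (process R b) bad)
          ≤⟨ 𝔼-mono (sample-⊆ (suc i*) T) (λ R _ → process-bad b R) ⟩
        𝔼 (sample (suc i*) T) (λ R → 1ℚ ℚ.- isolated R)
          ≡⟨ 𝔼-complement (sample (suc i*) T) isolated ⟩
        1ℚ ℚ.- 𝔼 (sample (suc i*) T) isolated
          ≡⟨ ≡.cong (λ z → 1ℚ ℚ.- z) (𝔼-sample (suc i*) T S* isOne isPositive) ⟩
        1ℚ ℚ.- (binomial (2⁻ suc i*) ∣ T ∩ S* ∣ isOne) ℚ.* (binomial (2⁻ suc i*) ∣ T ∩ ∁ S* ∣ isPositive)
          ≤⟨ ℚₚ.+-monoʳ-≤ 1ℚ (ℚₚ.neg-antimono-≤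
               (⅛≤isolation i* (∣ T ∩ S* ∣) (∣ T ∩ ∁ S* ∣) i*-lower i*-upper S*-small)) ⟩
        ⅞ ∎
        where open ℚₚ.≤-Reasoning

      i*-in-range : suc i* ∈ₗ applyUpTo ℕ.suc ⌈log₂ ∣ T ∣ ⌉
      i*-in-range = ∈-applyUpTo⁺ suc (begin
        suc i*                      ≡⟨ ⌈log₂2^n⌉≡n (suc i*) ⟨
        ⌈log₂ 2 ℕ.^ suc i* ⌉        ≤⟨ ⌈log₂⌉-mono-≤ (begin
          -- The far side of `S*` holds at least one terminal, so `k + 1 ≤ ∣ T ∣` and the rate
          -- `2⁻ suc i*` is among those tried.
          2 ℕ.^ suc i*                      ≤⟨ i*-lower ⟩
          suc ∣ T ∩ S* ∣                    ≡⟨ ℕₚ.+-comm 1 ∣ T ∩ S* ∣ ⟩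
          ∣ T ∩ S* ∣ ℕ.+ 1                  ≤⟨ ℕₚ.+-monoʳ-≤ ∣ T ∩ S* ∣ outer ⟩
          ∣ T ∩ S* ∣ ℕ.+ ∣ T ∩ ∁ S* ∣       ≡⟨ ∣p∩q∣+∣p∩∁q∣≡∣p∣ T S* ⟩
          ∣ T ∣                             ∎) ⟩
        ⌈log₂ ∣ T ∣ ⌉               ∎)
        where
        open ℕₚ.≤-Reasoning
        outer : 1 ℕ.≤ ∣ T ∩ ∁ S* ∣
        outer = ℕₚ.≤-trans (nonempty⇒1≤∣p∣ (≡.subst Nonempty (∩-comm S* T)
          (let (_ , t , t∈ , _) = proj₁ (proj₂ (proj₁ S*-minimum)) in t , t∈))) S*-small

      repeat : ℕ → Best K A G → Prog (Best K A G)
      repeat i b = charge 1 (forEach (applyUpTo ℕ.suc ⌈log₈⸝₇ n ⌉) b λ j b′ → charge 1 (round K A G T i b′))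

      repeat-valid : ∀ i b → Valid b → Always Valid (repeat i b)
      repeat-valid i b valid = charge (always-forEach (applyUpTo ℕ.suc ⌈log₈⸝₇ n ⌉)
        (λ j _ b valid → charge (round-valid i b valid)) valid)

      search : Prog (Best K A G)
      search = forEach (applyUpTo ℕ.suc ⌈log₂ ∣ T ∣ ⌉) nothing repeat

      search-valid : Always Valid search
      search-valid = always-forEach (applyUpTo ℕ.suc ⌈log₂ ∣ T ∣ ⌉) (λ i _ → repeat-valid i) nothing

      search-bad : .{{_ : ℕ.NonZero n}} → 𝔼 search bad ℚ.≤ (+ 1) ℚ./ n
      search-bad = ℚₚ.≤-trans
        (𝔼-forEach-∈ bad repeat-valid (^-nonNeg (ℚₚ.≤ᵇ⇒≤ _) J)
          (λ i b → 𝔼-forEach-≤ bad (λ j b valid → charge (round-valid i b valid))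
            (λ j b _ → round-bad i b) (applyUpTo ℕ.suc J) b)
          (λ b valid → ≡.subst (λ k → 𝔼 (repeat (suc i*) b) bad ℚ.≤ ⅞ ^ k ℚ.* bad b) (length-applyUpTo ℕ.suc J)
            (𝔼-forEach-^ bad (λ j b valid → charge (round-valid (suc i*) b valid))
              (ℚₚ.≤ᵇ⇒≤ _) (λ j b _ → round-i*-bad b) (applyUpTo ℕ.suc J) b valid))
          i*-in-range nothing nothing)
        (ℚₚ.≤-trans (ℚₚ.≤-reflexive (ℚₚ.*-identityʳ (⅞ ^ J))) (⅞^k≤1/n n J (proj₁ (log₈⸝₇-correct n))))
        where J = ⌈log₈⸝₇ n ⌉

      success : Best K A G → ℚ
      success b = if does (dec (approxMinSteinerCut? K ε G T) (Maybe.map proj₂ b)) then 1ℚ else 0ℚ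

      good⇒approximate : ∀ {b} → Valid b → Good b → Any (ApproxMinSteinerCut K ε G T) (Maybe.map proj₂ b)
      good⇒approximate (just (x≈ , steiner)) (just x≤) = just (steiner , S* , S*-minimum , ≤-respˡ-≈ x≈ x≤)

      valid⇒1-bad≤success : ∀ b → Valid b → 1ℚ ℚ.- bad b ℚ.≤ success b
      valid⇒1-bad≤success b valid with good? b
      ... | yes good = ℚₚ.≤-reflexive (≡.cong (λ t → if t then 1ℚ else 0ℚ) (≡.sym
        (dec-true (dec (approxMinSteinerCut? K ε G T) (Maybe.map proj₂ b)) (good⇒approximate valid good))))
      ... | no  _ with does (dec (approxMinSteinerCut? K ε G T) (Maybe.map proj₂ b))
      ...   | true  = ℚₚ.≤ᵇ⇒≤ _
      ...   | false = ℚₚ.≤-refl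

      success-probability : .{{_ : ℕ.NonZero n}} →
        1ℚ ℚ.- (+ 1) ℚ./ n ℚ.≤ Pr (approxSteinerCut K A G T) (dec (approxMinSteinerCut? K ε G T))
      success-probability = begin
        1ℚ ℚ.- (+ 1) ℚ./ n
          ≤⟨ ℚₚ.+-monoʳ-≤ 1ℚ (ℚₚ.neg-antimono-≤ search-bad) ⟩
        1ℚ ℚ.- 𝔼 search bad
          ≡⟨ 𝔼-complement search bad ⟨
        𝔼 search (λ b → 1ℚ ℚ.- bad b)
          ≤⟨ 𝔼-mono search-valid valid⇒1-bad≤success ⟩
        𝔼 search success
          ≡⟨ 𝔼->>= search _ _ ⟨
        𝔼 (approxSteinerCut K A G T) (λ S → if does (dec (approxMinSteinerCut? K ε G T) S) then 1ℚ else 0ℚ)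
          ≡⟨ Pr≡𝔼 (approxSteinerCut K A G T) (dec (approxMinSteinerCut? K ε G T)) ⟨
        Pr (approxSteinerCut K A G T) (dec (approxMinSteinerCut? K ε G T)) ∎
        where open ℚₚ.≤-Reasoning

    success-probability : .{{_ : NonZero n}} →
      1ℚ ℚ.- (+ 1) ℚ./ n ℚ.≤ Pr (approxSteinerCut K A G T) (dec (approxMinSteinerCut? K ε G T))
    success-probability = Search.success-probability S S-minimum small i lower upper
      where
      S = proj₁ smallMinimum
      S-minimum = proj₁ (proj₂ smallMinimum)
      small = proj₂ (proj₂ smallMinimum)
      terminal = proj₁ (proj₂ (proj₁ S-minimum))
      scale = ∃-scale ∣ T ∩ S ∣ (nonempty⇒1≤∣p∣ (≡.subst Nonempty (∩-comm S T)
        (proj₁ (proj₂ terminal) , proj₁ (proj₂ (proj₂ terminal)))))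
      i = proj₁ scale
      lower = proj₁ (proj₂ scale)
      upper = proj₂ (proj₂ scale)

open Correctness using (success-probability)

-- Running time

module _ where

  open import Data.Nat.Base using (_+_; _*_; _^_; _≤_)
  open ≡ using (refl; sym; trans; cong; cong₂)
  open ℕₚ
  open FiniteSum +-0-commutativeMonoid
  open Sum +-0-commutativeMonoid using (sum; ∑-comm; ∑-distrib-+; sum-cong-≗)

  -- After exchanging the sums, each vertex `v` receives its weight from at most one `t`.
  sum-disjoint : ∀ {n} (R : Subset n) (S : Fin n → Subset n) →
    (∀ t t′ v → t ∈ R → t′ ∈ R → v ∈ S t → v ∈ S t′ → t ≡ t′) → (w : Fin n → ℕ) →
    sum (λ t → if does (t ∈? R) then sum (λ v → if does (v ∈? S t) then w v else 0) else 0) ≤ sum w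
  sum-disjoint R S disjoint w = begin
    sum (λ t → if does (t ∈? R) then sum (λ v → if does (v ∈? S t) then w v else 0) else 0)
      ≡⟨ sum-cong-≗ (λ t → if-sum (does (t ∈? R)) (λ v → if does (v ∈? S t) then w v else 0)) ⟩
    sum (λ t → sum (λ v → term t v))  ≡⟨ ∑-comm term ⟩
    sum (λ v → sum (λ t → term t v))  ≤⟨ sum-mono-≤ at-most-one ⟩
    sum w                             ∎
    where
    open ≤-Reasoning
    term : Fin _ → Fin _ → ℕ
    term t v = if does (t ∈? R) then (if does (v ∈? S t) then w v else 0) else 0
    term-≤ : ∀ t v → term t v ≤ w v
    term-≤ t v with does (t ∈? R) | does (v ∈? S t)
    ... | true  | true  = ≤-refl
    ... | true  | false = z≤n
    ... | false | _     = z≤n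
    term-zero : ∀ t v → ¬ (t ∈ R × v ∈ S t) → term t v ≡ 0
    term-zero t v ∉ with t ∈? R | v ∈? S t
    ... | yes t∈R | yes v∈S = contradiction (t∈R , v∈S) ∉
    ... | yes _   | no _    = refl
    ... | no _    | _       = refl
    at-most-one : ∀ v → sum (λ t → term t v) ≤ w v
    at-most-one v with Finₚ.any? (λ t → (t ∈? R) ×-dec (v ∈? S t))
    ... | yes (t , t∈R , v∈S) = ≤-trans (≤-reflexive (sum-single {f = λ t → term t v} t (λ t′ t′≢t →
          term-zero t′ v λ (t′∈R , v∈S′) → t′≢t (disjoint t′ t v t′∈R t∈R v∈S′ v∈S)))) (term-≤ t v)
    ... | no ∄ = ≤-trans (≤-reflexive (sum-zero {f = λ t → term t v} λ t → term-zero t v λ h → ∄ (t , h))) z≤n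

  sum-≟ : ∀ {n} (u : Fin n) → sum (λ v → if does (v Finₚ.≟ u) then 1 else 0) ≡ 1
  sum-≟ u = trans (sum-single u λ v v≢u → cong (if_then 1 else 0) (dec-false (v Finₚ.≟ u) v≢u))
                  (cong (if_then 1 else 0) (dec-true (u Finₚ.≟ u) refl))

  module RunningTime {c ℓ₁ ℓ₂} (K : ArchimedeanOrderedField c ℓ₁ ℓ₂)
                     {ε} (A : IsolatingCuts K ε) {n m : ℕ} (G : Graph K n m) where

    open ArchimedeanOrderedField K using (0#)
    open Graph G using (src; tgt; incident)
    open IsolatingCuts A

    degree work : Fin n → ℕ
    degree v = foldr (λ _ z → 1 + z) 0 (incident v)
    work v = 1 + degree v

    sum-degree : sum degree ≤ m * 2
    sum-degree = begin
      sum degree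
        ≡⟨ sum-cong-≗ (λ v → sum-filter (λ e → (v Finₚ.≟ src e) ⊎-dec (v Finₚ.≟ tgt e)) (λ _ → 1)) ⟩
      sum (λ v → sum (λ e → endpoint v e))
        ≡⟨ ∑-comm endpoint ⟩
      sum (λ e → sum (λ v → endpoint v e))
        ≤⟨ sum-mono-≤ (λ e → ≤-trans (sum-mono-≤ λ v → endpoint-≤ v e) (≤-reflexive
             (trans (∑-distrib-+ (λ v → if does (v Finₚ.≟ src e) then 1 else 0)
                                 (λ v → if does (v Finₚ.≟ tgt e) then 1 else 0))
                    (cong₂ _+_ (sum-≟ (src e)) (sum-≟ (tgt e)))))) ⟩
      sum {m} (λ _ → 2)
        ≡⟨ sum-const m 2 ⟩
      m * 2 ∎
      where
      open ≤-Reasoning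
      endpoint : Fin n → Fin m → ℕ
      endpoint v e = if does ((v Finₚ.≟ src e) ⊎-dec (v Finₚ.≟ tgt e)) then 1 else 0
      endpoint-≤ : ∀ v e → endpoint v e ≤
        (if does (v Finₚ.≟ src e) then 1 else 0) + (if does (v Finₚ.≟ tgt e) then 1 else 0)
      endpoint-≤ v e with does (v Finₚ.≟ src e) | does (v Finₚ.≟ tgt e)
      ... | true  | _     = s≤s z≤n
      ... | false | true  = ≤-refl
      ... | false | false = z≤n

    sum-work : sum work ≤ n * 1 + m * 2
    sum-work = ≤-trans
      (≤-reflexive (trans (∑-distrib-+ {n} (λ _ → 1) degree) (cong (_+ sum degree) (sum-const n 1))))
      (+-monoʳ-≤ (n * 1) sum-degree)

    time-cutValue : ∀ S → time (cutValue K A G S) ≤ sum (λ v → if does (v ∈? S) then work v else 0)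
    time-cutValue S = ≤-trans
      (time-forEach _ work
        (λ v x → s≤s (time-forEach _ (λ _ → 1) (λ e y → ≤-refl {1}) (incident v) x)) (elements S) 0#)
      (≤-reflexive (sum-filter (_∈? S) work))

    -- Each terminal costs 2 steps of bookkeeping, one in the loop and one in `improve`. By
    -- disjointness the scans together cost at most the total work of all vertices, which is linear
    -- by the handshake count.
    time-cuts : ∀ R → 2 ≤ ∣ R ∣ → ∀ b →
      time (forEach (elements R) b λ t b′ → charge 1 (improve K A G (cuts G R t) b′)) ≤ n * 2 + (n * 1 + m * 2)
    time-cuts R 2≤ b = begin
      time (forEach (elements R) b λ t b′ → charge 1 (improve K A G (cuts G R t) b′))
        ≤⟨ time-forEach (λ t b → charge 1 (improve K A G (cuts G R t) b)) (λ t → 2 + value t)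
             (λ t b → s≤s (≤-trans
               (time->>=-≤ (cutValue K A G (cuts G R t)) _ (time-cutValue (cuts G R t)) (λ _ → ≤-refl))
               (≤-reflexive (+-comm (value t) 1))))
             (elements R) b ⟩
      foldr (λ t z → (2 + value t) + z) 0 (elements R)
        ≡⟨ sum-filter (_∈? R) (λ t → 2 + value t) ⟩
      sum (λ t → if does (t ∈? R) then 2 + value t else 0)
        ≤⟨ sum-mono-≤ (λ t → split (does (t ∈? R)) (value t)) ⟩
      sum (λ t → 2 + (if does (t ∈? R) then value t else 0))
        ≡⟨ ∑-distrib-+ (λ _ → 2) (λ t → if does (t ∈? R) then value t else 0) ⟩
      sum {n} (λ _ → 2) + sum (λ t → if does (t ∈? R) then value t else 0)
        ≤⟨ +-mono-≤ (≤-reflexive (sum-const n 2)) (≤-trans (sum-disjoint R (cuts G R) disjoint′ work) sum-work) ⟩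
      n * 2 + (n * 1 + m * 2) ∎
      where
      open ≤-Reasoning
      value : Fin n → ℕ
      value t = sum (λ v → if does (v ∈? cuts G R t) then work v else 0)
      split : ∀ b x → (if b then 2 + x else 0) ≤ 2 + (if b then x else 0)
      split true  x = ≤-refl
      split false x = z≤n
      disjoint′ : ∀ t t′ v → t ∈ R → t′ ∈ R → v ∈ cuts G R t → v ∈ cuts G R t′ → t ≡ t′
      disjoint′ t t′ v t∈R t′∈R v∈ v∈′ with t Finₚ.≟ t′
      ... | yes t≡t′ = t≡t′
      ... | no  t≢t′ = contradiction (v , x∈p∩q⁺ (v∈ , v∈′)) (disjoint G R 2≤ t t′ t∈R t′∈R t≢t′)

    module _ {B : ℕ} (cost≤B : ∀ R → 2 ≤ ∣ R ∣ → cost G R ≤ B) (T : Subset n) where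

      time-round : ∀ i b → time (round K A G T i b) ≤ n * suc i + (n + (B + (n * 2 + (n * 1 + m * 2))))
      time-round i b = time->>=-≤ (sample i T) _ (time-sample i T) λ R → +-monoʳ-≤ n (process R)
        where
        process : ∀ R → time (if does (2 ≤? ∣ R ∣)
          then charge (cost G R) (forEach (elements R) b λ t b′ → charge 1 (improve K A G (cuts G R t) b′))
          else return b) ≤ B + (n * 2 + (n * 1 + m * 2))
        process R with 2 ≤? ∣ R ∣
        ... | yes 2≤ rewrite dec-true (2 ≤? ∣ R ∣) 2≤ = +-mono-≤ (cost≤B R 2≤) (time-cuts R 2≤ b)
        ... | no  2≰ rewrite dec-false (2 ≤? ∣ R ∣) 2≰ = z≤n

      time-approxSteinerCut : let L = ⌈log₂ ∣ T ∣ ⌉ ; J = ⌈log₈⸝₇ n ⌉ in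
        time (approxSteinerCut K A G T) ≤
        n + (L * (1 + J * (1 + (n * suc L + (n + (B + (n * 2 + (n * 1 + m * 2))))))) + (n + 0))
      time-approxSteinerCut = +-monoʳ-≤ n (time->>=-≤ (forEach (applyUpTo suc L) nothing repeat) _
        (time-forEach-range repeat L (λ i i≤L b → s≤s (time-forEach-range _ J (λ j _ b →
          s≤s (≤-trans (time-round i b) (+-monoˡ-≤ _ (*-monoʳ-≤ n (s≤s i≤L))))) b)) nothing)
        (λ _ → ≤-refl))
        where
        L = ⌈log₂ ∣ T ∣ ⌉
        J = ⌈log₈⸝₇ n ⌉
        repeat : ℕ → Best K A G → Prog (Best K A G)
        repeat i b = charge 1 (forEach (applyUpTo suc J) b λ j b′ → charge 1 (round K A G T i b′))

  -- Every quantity is compared to U, which stands for m Lᵏ.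
  polylog-≤ : ∀ {n a m B D L L′ J U} → n ≤ a * U → m ≤ U → B ≤ D * U → 1 ≤ U → 1 ≤ L → L′ ≤ L → J ≤ 6 * L →
    n + (L′ * (1 + J * (1 + (n * suc L′ + (n + (B + (n * 2 + (n * 1 + m * 2))))))) + (n + 0))
    ≤ (19 + (38 * a + 6 * D)) * (L * L * L * U)
  polylog-≤ {n} {a} {m} {B} {D} {L} {L′} {J} {U} n≤ m≤ B≤ 1≤U 1≤L L′≤L J≤ = begin
    n + (L′ * (1 + J * (1 + (n * suc L′ + (n + (B + (n * 2 + (n * 1 + m * 2))))))) + (n + 0))
      -- The three factors `L` come from the number of rates, the `6 L` repetitions per rate, and
      -- the coin tosses per terminal, where `suc L′ ≤ 2 L`. Lower-order terms are padded to `L³ U`,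
      -- and the constants 19, 38 and 6 collect the coefficients.
      ≤⟨ +-mono-≤ n≤₃ (+-mono-≤ (*-mono-≤ L′≤L (+-mono-≤ 1≤₂ (*-mono-≤ J≤ (+-mono-≤ 1≤₁
           (+-mono-≤ nL (+-mono-≤ n≤₁ (+-mono-≤ B≤₁ (+-mono-≤ (*-monoˡ-≤ 2 n≤₁)
             (+-mono-≤ (*-monoˡ-≤ 1 n≤₁) (*-monoˡ-≤ 2 m≤₁)))))))))) (+-monoˡ-≤ 0 n≤₃)) ⟩
    a * (L * L * L * U) + (L * (L * L * U + 6 * L * (L * U
      + (a * U * (2 * L) + (a * (L * U) + (D * (L * U) + (a * (L * U) * 2
      + (a * (L * U) * 1 + L * U * 2))))))) + (a * (L * L * L * U) + 0))
      ≡⟨ solve 4 (λ a D L U →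
           a :* (L :* L :* L :* U) :+ (L :* (L :* L :* U :+ con 6 :* L :* (L :* U
             :+ (a :* U :* (con 2 :* L) :+ (a :* (L :* U) :+ (D :* (L :* U) :+ (a :* (L :* U) :* con 2
             :+ (a :* (L :* U) :* con 1 :+ L :* U :* con 2))))))) :+ (a :* (L :* L :* L :* U) :+ con 0))
           := (con 19 :+ (con 38 :* a :+ con 6 :* D)) :* (L :* L :* L :* U)) refl a D L U ⟩
    (19 + (38 * a + 6 * D)) * (L * L * L * U) ∎
    where
    open ≤-Reasoning
    grow : ∀ {x y} → 1 ≤ x → y ≤ x * y
    grow {x} {y} 1≤x = ≤-trans (≤-reflexive (sym (*-identityˡ y))) (*-monoˡ-≤ y 1≤x)
    U≤₁ : U ≤ L * U
    U≤₁ = grow 1≤L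
    U≤₂ : U ≤ L * L * U
    U≤₂ = grow (*-mono-≤ 1≤L 1≤L)
    U≤₃ : U ≤ L * L * L * U
    U≤₃ = grow (*-mono-≤ (*-mono-≤ 1≤L 1≤L) 1≤L)
    1≤₁ : 1 ≤ L * U
    1≤₁ = ≤-trans 1≤U U≤₁
    1≤₂ : 1 ≤ L * L * U
    1≤₂ = ≤-trans 1≤U U≤₂
    n≤₁ : n ≤ a * (L * U)
    n≤₁ = ≤-trans n≤ (*-monoʳ-≤ a U≤₁)
    n≤₃ : n ≤ a * (L * L * L * U)
    n≤₃ = ≤-trans n≤ (*-monoʳ-≤ a U≤₃)
    m≤₁ : m ≤ L * U
    m≤₁ = ≤-trans m≤ U≤₁
    B≤₁ : B ≤ D * (L * U)
    B≤₁ = ≤-trans B≤ (*-monoʳ-≤ D U≤₁)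
    nL : n * suc L′ ≤ a * U * (2 * L)
    nL = *-mono-≤ n≤ (≤-trans (+-mono-≤ 1≤L L′≤L) (≤-reflexive (cong (λ z → L + z) (sym (+-identityʳ L)))))
    open ℕSolver.+-*-Solver

  running-time : ∀ {c ℓ₁ ℓ₂} (K : ArchimedeanOrderedField c ℓ₁ ℓ₂) →
    let module K = ArchimedeanOrderedField K in
    {ε : K.Carrier} → K.0# K.< ε → (A : IsolatingCuts K ε) → ∀ d a →
    ∃₂ λ C k → ∀ {n m} (G : Graph K n m) → WeightRatioAtMost K (n ^ d) G →
    (T : Subset n) → 2 ≤ ∣ T ∣ → n ≤ a * m →
    time (approxSteinerCut K A G T) ≤ C * m * ⌈log₂ n ⌉ ^ k
  running-time K {ε} 0<ε A d a
    with IsolatingCuts.cost-bound A d a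
       | ·-≤-scale (*-positive (*-positive 0<ε 0<ε) 0<ε)
    where open OrderedField K using (·-≤-scale; *-positive)
  ... | C , k , cost-bound | M , unscale = C′ , 3 + k , bound
    where
    C′ = 19 + (38 * a + 6 * (C * M))
    bound : ∀ {n m} (G : Graph K n m) → WeightRatioAtMost K (n ^ d) G →
      (T : Subset n) → 2 ≤ ∣ T ∣ → n ≤ a * m →
      time (approxSteinerCut K A G T) ≤ C′ * m * ⌈log₂ n ⌉ ^ (3 + k)
    bound {n} {m} G ratio T 2≤∣T∣ n≤am = ≤-trans
      (RunningTime.time-approxSteinerCut K A G cost≤ T)
      (≤-trans
        (polylog-≤ {a = a} {D = C * M} (≤-trans n≤am (*-monoʳ-≤ a m≤U)) m≤U ≤-refl 1≤U 1≤L
          (⌈log₂⌉-mono-≤ (∣p∣≤n T)) (proj₂ (log₈⸝₇-correct n)))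
        (≤-reflexive (solve 4 (λ c m L P → c :* (L :* L :* L :* (m :* P)) := c :* m :* (L :* (L :* (L :* P))))
          refl C′ m L P)))
      where
      open ℕSolver.+-*-Solver
      L = ⌈log₂ n ⌉
      P = L ^ k
      U = m * P
      2≤n : 2 ≤ n
      2≤n = ≤-trans 2≤∣T∣ (∣p∣≤n T)
      1≤L : 1 ≤ L
      1≤L = ⌈log₂⌉-mono-≤ {2} {n} 2≤n
      1≤P : 1 ≤ P
      1≤P = m^n>0 L {{ℕ.>-nonZero 1≤L}} k
      1≤m : 1 ≤ m
      -- With no edges, `n ≤ a * m` would force `n = 0`, yet there are at least two terminals.
      1≤m = n≢0⇒n>0 λ { refl → contradiction (≤-trans 2≤n (≤-trans n≤am (≤-reflexive (*-zeroʳ a)))) λ () }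
      1≤U : 1 ≤ U
      1≤U = *-mono-≤ 1≤m 1≤P
      m≤U : m ≤ U
      m≤U = ≤-trans (≤-reflexive (sym (*-identityʳ m))) (*-monoʳ-≤ m 1≤P)
      cost≤ : ∀ R → 2 ≤ ∣ R ∣ → IsolatingCuts.cost A G R ≤ C * M * U
      cost≤ R 2≤ = ≤-trans (unscale _ (C * m * P) (cost-bound G ratio n≤am R 2≤))
        (≤-reflexive (solve 4 (λ C m P M → C :* m :* P :* M := C :* M :* (m :* P)) refl C m P M))

open import Data.Nat.Base using (_≤_; _*_; _^_)

theorem6p6 : ∀ {c ℓ₁ ℓ₂} (K : ArchimedeanOrderedField c ℓ₁ ℓ₂) →
    let module K = ArchimedeanOrderedField K in
    (ε : K.Carrier) → K.0# K.< ε → ε K.< K.1# →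
    (A : IsolatingCuts K ε) →
    (d a : ℕ) → ∃₂ λ (C k : ℕ) →
    ∀ {n m} .{{_ : NonZero n}} (G : Graph K n m) → WeightRatioAtMost K (n ^ d) G →
    (T : Subset n) → 2 ≤ ∣ T ∣ →
    (1ℚ ℚ.- (+ 1) ℚ./ n ℚ.≤ Pr (approxSteinerCut K A G T) (dec (approxMinSteinerCut? K ε G T)))
    × (n ≤ a * m → time (approxSteinerCut K A G T) ≤ C * m * ⌈log₂ n ⌉ ^ k)
theorem6p6 K ε 0<ε ε<1 A d a =
  proj₁ fast , proj₁ (proj₂ fast) , λ G ratio T 2≤∣T∣ →
    success-probability K 0<ε A G T 2≤∣T∣ , proj₂ (proj₂ fast) G ratio T 2≤∣T∣
  where
  fast = running-time K 0<ε A d a
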